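{- With $P_{\mathcal{B}_0}(z)=1$, for all $n\ge1$, \[P_{\mathcal{B}_n}(z)=zP_{\mathcal{B}_{n-1}}(z)+\sum_{k=1}^{n-1}\binom{n-1}{k}2^kP_{\mathcal{B}_{n-1-k}}(z)P_{\mathcal{A}_{k+1}}(z).\]
   Context: $\mathcal{A}_m$ is the braid arrangement in $\mathbb{R}^m$ (hyperplanes $x_i=x_j$, $i<j$); $\mathcal{B}_m$ is the arrangement in $\mathbb{R}^m$ of hyperplanes $x_i=\pm x_j$ ($i<j$) and $x_i=0$. For an arrangement $\mathcal{A}$, $P_{\mathcal{A}}(z)=\sum_{\mathrm{X}}|\mu(\bot,\mathrm{X})|(z-1)^{\operatorname{codim}\mathrm{X}}$, summed over flats (intersections of subsets of hyperplanes), $\mu$ the Möbius function of the lattice of flats under inclusion, $\bot$ its minimum. -}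

module Defs where

open import Algebra.Bundles using (CommutativeRing; Semiring)
import Algebra.Definitions.RawSemiring as RawSemiring
import Algebra.Properties.Ring as RingProperties
import Algebra.Properties.Semiring.Sum as SemiringSum
open import Data.Bool.Base using (if_then_else_)
open import Data.Fin.Base using (Fin; zero; suc; punchIn)
import Data.Fin.Properties as Fin
open import Data.Integer.Base as ℤ using (ℤ; 0ℤ; 1ℤ; ∣_∣)
open import Data.List.Base using (List; []; _∷_; _++_; map; foldr; filter; length; deduplicate; allFin; cartesianProduct; applyUpTo)
open import Data.List.Membership.Propositional using (_∈_)
open import Data.List.Membership.Propositional.Properties using (∈-filter⁻; ∈-deduplicate⁻; ∈-++⁻; ∈-map⁻)
open import Data.List.Properties using (map-cong-local; length-filter)
open import Data.List.Relation.Unary.All as All using (All; []; _∷_)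
open import Data.List.Relation.Unary.Any using (here; there)
open import Data.Nat.Base as ℕ using (ℕ; zero; suc; z≤n; s≤s)
import Data.Nat.Properties as ℕ
open import Data.Product.Base using (_×_; _,_; ∃; ∃₂; proj₁; proj₂)
open import Data.Rational.Base as ℚ using (1ℚ)
import Data.Rational.Properties as ℚ
open import Data.Sum.Base using (inj₁; inj₂)
open import Data.Vec.Functional as Vector using (Vector)
import Data.Vec.Functional.Properties as Vector
open import Level using (Level; _⊔_) renaming (suc to lsuc)
open import Relation.Binary.Bundles using (DecPoset)
open import Relation.Binary.Core using (Rel)
import Relation.Binary.Construct.NonStrictToStrict as NonStrictToStrict
import Relation.Binary.Construct.On as On
open import Relation.Binary.Definitions using (Decidable)
open import Relation.Binary.PropositionalEquality as ≡ using (_≡_)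
import Relation.Binary.Reasoning.Setoid as SetoidReasoning
open import Relation.Binary.Structures using (IsStrictTotalOrder)
open import Relation.Nullary using (¬_; Dec; yes; no; does; contradiction)
open import Relation.Nullary.Decidable using (_×-dec_; ¬?; map′; decidable-stable; dec-true; dec-false)
open import Relation.Unary as Unary using (Pred; _⊆_; _≐_)
open import Relation.Unary.Relation.Binary.Subset using (⊆-isPartialOrder)

-- The standard library has no real numbers, so the scalars are the elements of
-- an arbitrary ordered field, of which ℝ is one.
record OrderedField (c ℓ₁ ℓ₂ : Level) : Set (lsuc (c ⊔ ℓ₁ ⊔ ℓ₂)) where
  field
    commutativeRing : CommutativeRing c ℓ₁

  open CommutativeRing commutativeRing public

  infix 4 _≺_
  field
    _≺_                : Rel Carrier ℓ₂
    isStrictTotalOrder : IsStrictTotalOrder _≈_ _≺_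
    0≺1                : 0# ≺ 1#
    +-monoʳ-≺          : ∀ x {y z} → y ≺ z → x + y ≺ x + z
    *-pos              : ∀ {x y} → 0# ≺ x → 0# ≺ y → 0# ≺ x * y
    inverse            : ∀ x → ¬ (x ≈ 0#) → ∃ λ y → x * y ≈ 1#

  open IsStrictTotalOrder isStrictTotalOrder public using (_≟_)

ℚ-orderedField : OrderedField _ _ _
ℚ-orderedField = record
  { commutativeRing    = ℚ.+-*-commutativeRing
  ; _≺_                = ℚ._<_
  ; isStrictTotalOrder = ℚ.<-isStrictTotalOrder
  ; 0≺1                = ℚ.positive⁻¹ 1ℚ
  ; +-monoʳ-≺          = ℚ.+-monoʳ-<
  ; *-pos              = λ {x} {y} 0<x 0<y →
      ℚ.positive⁻¹ (x ℚ.* y) {{ℚ.pos*pos⇒pos x {{ℚ.positive 0<x}} y {{ℚ.positive 0<y}}}}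
  ; inverse            = λ x x≢0 →
      let instance _ = ℚ.≢-nonZero x≢0 in ℚ.1/ x , ℚ.*-inverseʳ x
  }

private
  module _ {a p q} {A : Set a} {P : Pred A p} {Q : Pred A q}
           (P? : Unary.Decidable P) (Q? : Unary.Decidable Q) (P⊆Q : P ⊆ Q) where

    length-filter-≤ : ∀ xs → length (filter P? xs) ℕ.≤ length (filter Q? xs)
    length-filter-≤ [] = z≤n
    length-filter-≤ (x ∷ xs) with P? x | Q? x
    ... | yes _  | yes _  = s≤s (length-filter-≤ xs)
    ... | yes Px | no ¬Qx = contradiction (P⊆Q Px) ¬Qx
    ... | no _   | yes _  = ℕ.m≤n⇒m≤1+n (length-filter-≤ xs)
    ... | no _   | no _   = length-filter-≤ xs

    length-filter-< : ∀ {w} xs → w ∈ xs → ¬ P w → Q w →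
                      length (filter P? xs) ℕ.< length (filter Q? xs)
    length-filter-< (x ∷ xs) (here ≡.refl) ¬Pw Qw with P? x | Q? x
    ... | yes Px | _      = contradiction Px ¬Pw
    ... | no _   | yes _  = s≤s (length-filter-≤ xs)
    ... | no _   | no ¬Qx = contradiction Qw ¬Qx
    length-filter-< (x ∷ xs) (there w∈) ¬Pw Qw with P? x | Q? x
    ... | yes _  | yes _  = s≤s (length-filter-< xs w∈ ¬Pw Qw)
    ... | yes Px | no ¬Qx = contradiction (P⊆Q Px) ¬Qx
    ... | no _   | yes _  = ℕ.m≤n⇒m≤1+n (length-filter-< xs w∈ ¬Pw Qw)
    ... | no _   | no _   = length-filter-< xs w∈ ¬Pw Qw

-- The Möbius function of the finite subposet of P listed (without repetition
-- up to ≈) by elements.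
module Möbius {a ℓ₁ ℓ₂} (P : DecPoset a ℓ₁ ℓ₂)
              (elements : List (DecPoset.Carrier P)) where

  open DecPoset P using (Carrier; _≈_; _≤_; _≟_; _≤?_; isPartialOrder; module Eq)
  private module S = NonStrictToStrict _≈_ _≤_

  _<?_ : Decidable S._<_
  _<?_ = S.<-decidable _≟_ _≤?_

  [_,_⟩ : Carrier → Carrier → List Carrier
  [ x , y ⟩ = filter (λ w → (x ≤? w) ×-dec (w <? y)) elements

  sumℤ : List ℤ → ℤ
  sumℤ = foldr ℤ._+_ 0ℤ

  -- The first argument bounds the depth of the recursion. A bound exceeding the
  -- number of elements is never exhausted: see μ-≈ and μ-≉, which are the
  -- defining equations of the Möbius function.
  μ-bounded : ℕ → Carrier → Carrier → ℤ
  μ-bounded zero    x y = 0ℤ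
  μ-bounded (suc k) x y =
    if does (x ≟ y) then 1ℤ else ℤ.- sumℤ (map (μ-bounded k x) [ x , y ⟩)

  μ : Carrier → Carrier → ℤ
  μ = μ-bounded (suc (length elements))

  μ-≈ : ∀ {x y} → x ≈ y → μ x y ≡ 1ℤ
  μ-≈ {x} {y} x≈y rewrite dec-true (x ≟ y) x≈y = ≡.refl

  private
    height : Carrier → ℕ
    height y = length (filter (_<? y) elements)

    height-strict : ∀ {w y} → w ∈ elements → w S.< y → height w ℕ.< height y
    height-strict {w} {y} w∈els w<y =
      length-filter-< (_<? w) (_<? y) (λ v<w → S.<-trans isPartialOrder v<w w<y)
                      elements w∈els (S.<-irrefl Eq.refl) w<y

    stable : ∀ k l x y → height y ℕ.< k → height y ℕ.< l →
             μ-bounded k x y ≡ μ-bounded l x y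
    stable (suc k) (suc l) x y (s≤s h≤k) (s≤s h≤l) =
      ≡.cong (λ s → if does (x ≟ y) then 1ℤ else ℤ.- sumℤ s)
        (map-cong-local (All.tabulate λ {w} w∈ →
          let w∈els , _ , w<y = ∈-filter⁻ (λ w → (x ≤? w) ×-dec (w <? y)) {xs = elements} w∈
              h<h = height-strict w∈els w<y
          in stable k l x w (ℕ.<-≤-trans h<h h≤k) (ℕ.<-≤-trans h<h h≤l)))

  μ-≉ : ∀ {x y} → ¬ (x ≈ y) → μ x y ≡ ℤ.- sumℤ (map (μ x) [ x , y ⟩)
  μ-≉ {x} {y} x≉y =
    ≡.trans (stable N (suc N) x y (h<N y) (ℕ.m≤n⇒m≤1+n (h<N y))) unfold
    where
    N = suc (length elements)

    h<N : ∀ w → height w ℕ.< N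
    h<N w = s≤s (length-filter (_<? w) elements)

    unfold : μ-bounded (suc N) x y ≡ ℤ.- sumℤ (map (μ x) [ x , y ⟩)
    unfold rewrite dec-false (x ≟ y) x≉y = ≡.refl

module _ {a} {A : Set a} where

  sublists : List A → List (List A)
  sublists []       = [] ∷ []
  sublists (x ∷ xs) = sublists xs ++ map (x ∷_) (sublists xs)

  sublists-sound : ∀ {ys} (xs : List A) → ys ∈ sublists xs → All (_∈ xs) ys
  sublists-sound [] (here ≡.refl) = []
  sublists-sound (x ∷ xs) ys∈ with ∈-++⁻ (sublists xs) ys∈
  ... | inj₁ ys∈′ = All.map there (sublists-sound xs ys∈′)
  ... | inj₂ ys∈′ with ∈-map⁻ (x ∷_) ys∈′
  ...   | _ , zs∈ , ≡.refl = here ≡.refl ∷ All.map there (sublists-sound xs zs∈)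

module Arrangements {c ℓ₁ ℓ₂} (K : OrderedField c ℓ₁ ℓ₂) where

  open OrderedField K hiding (zero)
  open RingProperties ring using (-‿distribˡ-*; -‿distribʳ-*; -‿+-comm; +-cancelʳ)
  open SemiringSum semiring
  open SetoidReasoning setoid

  Point : ℕ → Set c
  Point m = Vector Carrier m

  record LinearForm (m : ℕ) : Set (c ⊔ ℓ₁) where
    field
      ⟦_⟧    : Point m → Carrier
      ⟦⟧-cong : ∀ {x y} → (∀ i → x i ≈ y i) → ⟦_⟧ x ≈ ⟦_⟧ y
      +-homo : ∀ x y → ⟦_⟧ (λ i → x i + y i) ≈ ⟦_⟧ x + ⟦_⟧ y
      *-homo : ∀ t x → ⟦_⟧ (λ i → t * x i) ≈ t * ⟦_⟧ x

  open LinearForm public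

  -- A list of forms stands for the hyperplanes on which they vanish.
  Arrangement : ℕ → Set (c ⊔ ℓ₁)
  Arrangement m = List (LinearForm m)

  ⋂ : ∀ {m} → List (LinearForm m) → Pred (Point m) (c ⊔ ℓ₁)
  ⋂ S x = All (λ f → ⟦ f ⟧ x ≈ 0#) S

  lincomb : ∀ {m d} → Vector Carrier d → Vector (Point m) d → Point m
  lincomb t b k = sum (λ i → t i * b i k)

  record IsBasis {m d} (b : Vector (Point m) d) (X : Pred (Point m) (c ⊔ ℓ₁)) : Set (c ⊔ ℓ₁) where
    field
      inside      : ∀ i → X (b i)
      spanning    : ∀ {x} → X x → ∃ λ t → ∀ k → lincomb t b k ≈ x k
      independent : ∀ t → (∀ k → lincomb t b k ≈ 0#) → ∀ i → t i ≈ 0#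

  open IsBasis

  zero-form : ∀ {m} (f : LinearForm m) → ⟦ f ⟧ (λ _ → 0#) ≈ 0#
  zero-form f = begin
    ⟦ f ⟧ (λ _ → 0#)       ≈⟨ ⟦⟧-cong f (λ _ → zeroˡ 0#) ⟨
    ⟦ f ⟧ (λ _ → 0# * 0#)  ≈⟨ *-homo f 0# _ ⟩
    0# * ⟦ f ⟧ (λ _ → 0#)  ≈⟨ zeroˡ _ ⟩
    0#                     ∎

  form-lincomb : ∀ {m d} (f : LinearForm m) (t : Vector Carrier d) (b : Vector (Point m) d) →
                 ⟦ f ⟧ (lincomb t b) ≈ sum (λ i → t i * ⟦ f ⟧ (b i))
  form-lincomb {d = zero}  f t b = zero-form f
  form-lincomb {d = suc d} f t b = begin
    ⟦ f ⟧ (lincomb t b)                                                        ≈⟨ +-homo f _ _ ⟩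
    ⟦ f ⟧ (λ k → t zero * b zero k) + ⟦ f ⟧ (lincomb (Vector.tail t) (Vector.tail b))
      ≈⟨ +-cong (*-homo f _ _) (form-lincomb f (Vector.tail t) (Vector.tail b)) ⟩
    sum (λ i → t i * ⟦ f ⟧ (b i))                                              ∎

  sum-zero : ∀ {d} (t : Vector Carrier d) → (∀ i → t i ≈ 0#) → sum t ≈ 0#
  sum-zero {d} t t≈0 = trans (sum-cong-≋ t≈0) (sum-replicate-zero d)

  form-lincomb-zero : ∀ {m d} (f : LinearForm m) (t : Vector Carrier d) (b : Vector (Point m) d) →
                      (∀ i → ⟦ f ⟧ (b i) ≈ 0#) → ⟦ f ⟧ (lincomb t b) ≈ 0#
  form-lincomb-zero f t b fb≈0 =
    trans (form-lincomb f t b)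
          (sum-zero _ (λ i → trans (*-congˡ (fb≈0 i)) (zeroʳ _)))

  δ : ∀ {m} → Fin m → Point m
  δ zero    zero    = 1#
  δ zero    (suc k) = 0#
  δ (suc i) zero    = 0#
  δ (suc i) (suc k) = δ i k

  lincomb-δ : ∀ {m} (t : Point m) k → lincomb t δ k ≈ t k
  lincomb-δ t zero = begin
    t zero * 1# + sum (λ i → t (suc i) * 0#) ≈⟨ +-cong (*-identityʳ _) (sum-zero (λ i → t (suc i) * 0#) (λ i → zeroʳ _)) ⟩
    t zero + 0#                              ≈⟨ +-identityʳ _ ⟩
    t zero                                   ∎
  lincomb-δ t (suc k) = begin
    t zero * 0# + lincomb (Vector.tail t) δ k ≈⟨ +-cong (zeroʳ _) (lincomb-δ (Vector.tail t) k) ⟩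
    0# + t (suc k)                            ≈⟨ +-identityˡ _ ⟩
    t (suc k)                                 ∎

  δ-isBasis : ∀ {m} → IsBasis {m} δ (⋂ [])
  δ-isBasis = record
    { inside      = λ _ → []
    ; spanning    = λ {x} _ → x , lincomb-δ x
    ; independent = λ t t≈0 i → trans (sym (lincomb-δ t i)) (t≈0 i)
    }

  module Pivot {m d} {S : List (LinearForm m)} (f : LinearForm m)
               (b : Vector (Point m) (suc d)) (isBasis : IsBasis b (⋂ S))
               (p : Fin (suc d)) (fbp≉0 : ¬ (⟦ f ⟧ (b p) ≈ 0#)) where

    u v : Carrier
    u = ⟦ f ⟧ (b p)
    v = proj₁ (inverse u fbp≉0)

    uv≈1 : u * v ≈ 1#
    uv≈1 = proj₂ (inverse u fbp≉0)

    w s : Vector Carrier d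
    w j = ⟦ f ⟧ (b (punchIn p j))
    s j = - (w j * v)

    b′ : Vector (Point m) d
    b′ j k = b (punchIn p j) k + s j * b p k

    s*u : ∀ j → s j * u ≈ - w j
    s*u j = begin
      - (w j * v) * u   ≈⟨ -‿distribˡ-* _ _ ⟨
      - (w j * v * u)   ≈⟨ -‿cong (*-assoc _ _ _) ⟩
      - (w j * (v * u)) ≈⟨ -‿cong (*-congˡ (trans (*-comm v u) uv≈1)) ⟩
      - (w j * 1#)      ≈⟨ -‿cong (*-identityʳ _) ⟩
      - w j             ∎

    form-b′ : ∀ (g : LinearForm m) j → ⟦ g ⟧ (b′ j) ≈ ⟦ g ⟧ (b (punchIn p j)) + s j * ⟦ g ⟧ (b p)
    form-b′ g j = trans (+-homo g _ _) (+-congˡ (*-homo g _ _))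

    f-b′ : ∀ j → ⟦ f ⟧ (b′ j) ≈ 0#
    f-b′ j = begin
      ⟦ f ⟧ (b′ j)    ≈⟨ form-b′ f j ⟩
      w j + s j * u   ≈⟨ +-congˡ (s*u j) ⟩
      w j + - w j     ≈⟨ -‿inverseʳ _ ⟩
      0#              ∎

    S-b′ : ∀ j → ⋂ S (b′ j)
    S-b′ j = All.zipWith (λ {g} (e₁ , e₂) → begin
        ⟦ g ⟧ (b′ j)                                    ≈⟨ form-b′ g j ⟩
        ⟦ g ⟧ (b (punchIn p j)) + s j * ⟦ g ⟧ (b p)     ≈⟨ +-cong e₁ (*-congˡ e₂) ⟩
        0# + s j * 0#                                   ≈⟨ +-identityˡ _ ⟩
        s j * 0#                                        ≈⟨ zeroʳ _ ⟩
        0#                                              ∎)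
      (inside isBasis (punchIn p j) , inside isBasis p)

    lincomb-b′ : ∀ t k → lincomb t b′ k
      ≈ sum (λ j → t j * s j) * b p k + sum (λ j → t j * b (punchIn p j) k)
    lincomb-b′ t k = begin
      sum (λ j → t j * (b (punchIn p j) k + s j * b p k))
        ≈⟨ sum-cong-≋ (λ j → begin
             t j * (b (punchIn p j) k + s j * b p k)         ≈⟨ distribˡ _ _ _ ⟩
             t j * b (punchIn p j) k + t j * (s j * b p k)   ≈⟨ +-comm _ _ ⟩
             t j * (s j * b p k) + t j * b (punchIn p j) k   ≈⟨ +-congʳ (*-assoc _ _ _) ⟨
             t j * s j * b p k + t j * b (punchIn p j) k     ∎) ⟩
      sum (λ j → t j * s j * b p k + t j * b (punchIn p j) k)
        ≈⟨ ∑-distrib-+ (λ j → t j * s j * b p k) _ ⟩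
      sum (λ j → t j * s j * b p k) + sum (λ j → t j * b (punchIn p j) k)
        ≈⟨ +-congʳ (*-distribʳ-sum (b p k) (λ j → t j * s j)) ⟨
      sum (λ j → t j * s j) * b p k + sum (λ j → t j * b (punchIn p j) k) ∎

    pivot-coefficient : ∀ {x} t → (∀ k → lincomb t b k ≈ x k) → ⟦ f ⟧ x ≈ 0# →
                        sum (λ j → t (punchIn p j) * s j) ≈ t p
    pivot-coefficient {x} t t-x fx≈0 = begin
      sum (λ j → t (punchIn p j) * s j)
        ≈⟨ *-identityʳ _ ⟨
      sum (λ j → t (punchIn p j) * s j) * 1#
        ≈⟨ *-congˡ uv≈1 ⟨
      sum (λ j → t (punchIn p j) * s j) * (u * v)
        ≈⟨ *-assoc _ _ _ ⟨
      sum (λ j → t (punchIn p j) * s j) * u * v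
        ≈⟨ *-congʳ same ⟩
      t p * u * v
        ≈⟨ *-assoc _ _ _ ⟩
      t p * (u * v)
        ≈⟨ *-congˡ uv≈1 ⟩
      t p * 1#
        ≈⟨ *-identityʳ _ ⟩
      t p ∎
      where
      W = sum (λ j → t (punchIn p j) * w j)

      cancel : t p * u + W ≈ 0#
      cancel = begin
        t p * u + W                        ≈⟨ sum-remove {i = p} (λ i → t i * ⟦ f ⟧ (b i)) ⟨
        sum (λ i → t i * ⟦ f ⟧ (b i))      ≈⟨ form-lincomb f t b ⟨
        ⟦ f ⟧ (lincomb t b)                ≈⟨ ⟦⟧-cong f t-x ⟩
        ⟦ f ⟧ x                            ≈⟨ fx≈0 ⟩
        0#                                 ∎

      cancel′ : sum (λ j → t (punchIn p j) * s j) * u + W ≈ 0#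
      cancel′ = begin
        sum (λ j → t (punchIn p j) * s j) * u + W
          ≈⟨ +-congʳ (*-distribʳ-sum u (λ j → t (punchIn p j) * s j)) ⟩
        sum (λ j → t (punchIn p j) * s j * u) + W
          ≈⟨ ∑-distrib-+ (λ j → t (punchIn p j) * s j * u) _ ⟨
        sum (λ j → t (punchIn p j) * s j * u + t (punchIn p j) * w j)
          ≈⟨ sum-zero _ (λ j → begin
               t (punchIn p j) * s j * u + t (punchIn p j) * w j    ≈⟨ +-congʳ (*-assoc _ _ _) ⟩
               t (punchIn p j) * (s j * u) + t (punchIn p j) * w j  ≈⟨ distribˡ _ _ _ ⟨
               t (punchIn p j) * (s j * u + w j)                    ≈⟨ *-congˡ (+-congʳ (s*u j)) ⟩
               t (punchIn p j) * (- w j + w j)                      ≈⟨ *-congˡ (-‿inverseˡ _) ⟩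
               t (punchIn p j) * 0#                                 ≈⟨ zeroʳ _ ⟩
               0#                                                   ∎) ⟩
        0# ∎

      same : sum (λ j → t (punchIn p j) * s j) * u ≈ t p * u
      same = +-cancelʳ W _ _ (trans cancel′ (sym cancel))

    isBasis′ : IsBasis b′ (⋂ (f ∷ S))
    isBasis′ .inside j = f-b′ j ∷ S-b′ j
    isBasis′ .spanning {x} (fx≈0 ∷ Sx) =
      let t , t-x = spanning isBasis Sx in
      (λ j → t (punchIn p j)) , λ k → begin
        lincomb (λ j → t (punchIn p j)) b′ k
          ≈⟨ lincomb-b′ _ k ⟩
        sum (λ j → t (punchIn p j) * s j) * b p k + sum (λ j → t (punchIn p j) * b (punchIn p j) k)
          ≈⟨ +-congʳ (*-congʳ (pivot-coefficient t t-x fx≈0)) ⟩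
        t p * b p k + sum (λ j → t (punchIn p j) * b (punchIn p j) k)
          ≈⟨ sum-remove {i = p} (λ i → t i * b i k) ⟨
        lincomb t b k
          ≈⟨ t-x k ⟩
        x k ∎
    isBasis′ .independent t t≈0 j = begin
      t j               ≡⟨ Vector.insertAt-punchIn t p σ j ⟨
      t⁺ (punchIn p j)  ≈⟨ independent isBasis t⁺ t⁺≈0 (punchIn p j) ⟩
      0#                ∎
      where
      σ = sum (λ i → t i * s i)
      t⁺ = Vector.insertAt t p σ

      t⁺≈0 : ∀ k → lincomb t⁺ b k ≈ 0#
      t⁺≈0 k = begin
        lincomb t⁺ b k
          ≈⟨ sum-remove {i = p} (λ i → t⁺ i * b i k) ⟩
        t⁺ p * b p k + sum (λ i → t⁺ (punchIn p i) * b (punchIn p i) k)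
          ≈⟨ +-cong (*-congʳ (reflexive (Vector.insertAt-lookup t p σ)))
                    (sum-cong-≋ (λ i → *-congʳ (reflexive (Vector.insertAt-punchIn t p σ i)))) ⟩
        σ * b p k + sum (λ i → t i * b (punchIn p i) k)
          ≈⟨ lincomb-b′ t k ⟨
        lincomb t b′ k
          ≈⟨ t≈0 k ⟩
        0# ∎

  unchanged : ∀ {m d} {S : List (LinearForm m)} (f : LinearForm m) {b : Vector (Point m) d} →
              IsBasis b (⋂ S) → (∀ i → ⟦ f ⟧ (b i) ≈ 0#) → IsBasis b (⋂ (f ∷ S))
  unchanged f isBasis fb≈0 = record
    { inside      = λ i → fb≈0 i ∷ inside isBasis i
    ; spanning    = λ { (_ ∷ Sx) → spanning isBasis Sx }
    ; independent = independent isBasis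
    }

  cut : ∀ {m d} {S : List (LinearForm m)} (f : LinearForm m) {b : Vector (Point m) d} →
        IsBasis b (⋂ S) → ∃₂ λ d′ (b′ : Vector (Point m) d′) → IsBasis b′ (⋂ (f ∷ S))
  cut {d = zero}  f isBasis = _ , _ , unchanged f isBasis λ ()
  cut {d = suc d} f {b} isBasis with Fin.any? (λ i → ¬? (⟦ f ⟧ (b i) ≟ 0#))
  ... | yes (p , fbp≉0) = _ , _ , Pivot.isBasis′ f b isBasis p fbp≉0
  ... | no  none        = _ , _ , unchanged f isBasis
          λ i → decidable-stable (⟦ f ⟧ (b i) ≟ 0#) (λ fbi≉0 → none (i , fbi≉0))

  basis : ∀ {m} (S : List (LinearForm m)) → ∃₂ λ d (b : Vector (Point m) d) → IsBasis b (⋂ S)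
  basis []      = _ , _ , δ-isBasis
  basis (f ∷ S) = cut f (proj₂ (proj₂ (basis S)))

  dim codim : ∀ {m} → List (LinearForm m) → ℕ
  dim S = proj₁ (basis S)
  codim {m} S = m ℕ.∸ dim S

  _⊆?_ : ∀ {m} (S T : List (LinearForm m)) → Dec (⋂ S ⊆ ⋂ T)
  S ⊆? T = let d , b , isBasis = basis S in
    map′ (λ Tb {x} Sx →
            let t , t-x = spanning isBasis Sx in
            All.map (λ {f} fb≈0 → trans (sym (⟦⟧-cong f t-x)) (form-lincomb-zero f t b fb≈0)) Tb)
         (λ S⊆T → All.tabulate λ f∈T i → All.lookup (S⊆T (inside isBasis i)) f∈T)
         (All.all? (λ f → Fin.all? λ i → ⟦ f ⟧ (b i) ≟ 0#) T)

  _≐?_ : ∀ {m} (S T : List (LinearForm m)) → Dec (⋂ S ≐ ⋂ T)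
  S ≐? T = (S ⊆? T) ×-dec (T ⊆? S)

  -- Intersections of hyperplanes, each represented by a list of forms cutting
  -- it out, identified when equal as sets of points and ordered by inclusion.
  intersections : ℕ → DecPoset (c ⊔ ℓ₁) (c ⊔ ℓ₁) (c ⊔ ℓ₁)
  intersections m = record
    { Carrier           = List (LinearForm m)
    ; _≈_               = λ S T → ⋂ S ≐ ⋂ T
    ; _≤_               = λ S T → ⋂ S ⊆ ⋂ T
    ; isDecPartialOrder = record
      { isPartialOrder = On.isPartialOrder ⋂ ⊆-isPartialOrder
      ; _≟_            = _≐?_
      ; _≤?_           = _⊆?_
      }
    }

  -- One representative of each flat.
  flats : ∀ {m} → Arrangement m → List (List (LinearForm m))
  flats 𝒜 = deduplicate _≐?_ (sublists 𝒜)

  -- The minimum flat is the intersection of all the hyperplanes.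
  bottom : ∀ {m} → Arrangement m → List (LinearForm m)
  bottom 𝒜 = 𝒜

  bottom-minimum : ∀ {m} (𝒜 : Arrangement m) {X} → X ∈ flats 𝒜 → ⋂ (bottom 𝒜) ⊆ ⋂ X
  bottom-minimum 𝒜 X∈ 𝒜x =
    All.map (All.lookup 𝒜x) (sublists-sound 𝒜 (∈-deduplicate⁻ _≐?_ (sublists 𝒜) X∈))

  μ : ∀ {m} → Arrangement m → (X Y : List (LinearForm m)) → ℤ
  μ {m} 𝒜 = Möbius.μ (intersections m) (flats 𝒜)

  coord : ∀ {m} → Fin m → LinearForm m
  coord i = record
    { ⟦_⟧     = λ x → x i
    ; ⟦⟧-cong = λ x≈y → x≈y i
    ; +-homo  = λ _ _ → refl
    ; *-homo  = λ _ _ → refl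
    }

  _⊕_ : ∀ {m} → LinearForm m → LinearForm m → LinearForm m
  f ⊕ g = record
    { ⟦_⟧     = λ x → ⟦ f ⟧ x + ⟦ g ⟧ x
    ; ⟦⟧-cong = λ x≈y → +-cong (⟦⟧-cong f x≈y) (⟦⟧-cong g x≈y)
    ; +-homo  = λ x y → trans (+-cong (+-homo f x y) (+-homo g x y)) (interchange _ _ _ _)
    ; *-homo  = λ t x → trans (+-cong (*-homo f t x) (*-homo g t x)) (sym (distribˡ _ _ _))
    }
    where
    open import Algebra.Properties.CommutativeSemigroup
      (CommutativeRing.+-commutativeSemigroup commutativeRing) using (interchange)

  ⊖_ : ∀ {m} → LinearForm m → LinearForm m
  ⊖ f = record
    { ⟦_⟧     = λ x → - ⟦ f ⟧ x
    ; ⟦⟧-cong = λ x≈y → -‿cong (⟦⟧-cong f x≈y)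
    ; +-homo  = λ x y → trans (-‿cong (+-homo f x y)) (sym (-‿+-comm _ _))
    ; *-homo  = λ t x → trans (-‿cong (*-homo f t x)) (-‿distribʳ-* _ _)
    }

  pairs : ∀ m → List (Fin m × Fin m)
  pairs m = filter (λ (i , j) → i Fin.<? j) (cartesianProduct (allFin m) (allFin m))

  𝓐 : ∀ m → Arrangement m
  𝓐 m = map (λ (i , j) → coord i ⊕ (⊖ coord j)) (pairs m)

  𝓑 : ∀ m → Arrangement m
  𝓑 m = map (λ (i , j) → coord i ⊕ (⊖ coord j)) (pairs m)
     ++ map (λ (i , j) → coord i ⊕ coord j) (pairs m)
     ++ map coord (allFin m)

  -- P 𝒜 has integer coefficients and is identified with its values at the
  -- elements z of all commutative rings; for ℤ[z] and its indeterminate the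
  -- value is the polynomial itself.
  module Polynomial {r ℓ} (R : CommutativeRing r ℓ) where

    private module R = CommutativeRing R
    open RawSemiring (Semiring.rawSemiring R.semiring) using (_^_)
    open RawSemiring (Semiring.rawSemiring R.semiring) public using () renaming (_×_ to _·_)

    sumR : List R.Carrier → R.Carrier
    sumR = foldr R._+_ R.0#

    P : ∀ {m} → Arrangement m → R.Carrier → R.Carrier
    P 𝒜 z = sumR (map (λ X → ∣ μ 𝒜 (bottom 𝒜) X ∣ · ((z R.- R.1#) ^ codim X)) (flats 𝒜))

    -- The sum of g k over the integers k with 1 ≤ k ≤ n.
    ∑₁ : ℕ → (ℕ → R.Carrier) → R.Carrier
    ∑₁ n g = sumR (applyUpTo (λ k → g (suc k)) n)

{-# OPTIONS --safe #-}
module Submission where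

-- A flat of 𝓑 m is read coordinate by coordinate, from the last to the first: a coordinate is
-- either free, or equal to 0 or to ± one of the c coordinates found free before it, which leaves
-- 1 + 2c choices. For 𝓐 (m + 1) one starts with one free coordinate and no zero or signs are
-- available, which leaves 1 + c choices. Hence flats below a given one extend as all flats do,
-- the values μ(⊥, X) = ∏ᵢ (− (number of choices at i)) over i < c sum to 0 over [⊥, X] for
-- X ≠ ⊥, and P becomes the iterate of a first-order recursion.
-- In terms of w = z − 1 and θ = s d/ds this recursion reads P (𝓑 n) = Tⁿ 1 at s = 1 with
-- T = (s + w)(1 + 2θ), and 2ᵏ P (𝓐 (k + 1)) = ∂ᵏ s at s = 1 with ∂ = 2 (s + w) θ. As T − ∂ is
-- multiplication by s + w, the theorem is the Leibniz rule for Tⁿ⁻¹ applied to T 1 = s + w.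

open import Defs
open import Algebra.Bundles using (CommutativeMonoid; CommutativeRing; Semiring)
import Algebra.Definitions.RawSemiring as RawSemiring
import Algebra.Properties.CommutativeMonoid.Mult as CommutativeMonoidMult
import Algebra.Properties.Monoid.Mult as MonoidMult
import Algebra.Properties.Ring as RingProperties
import Algebra.Properties.Semiring.Mult as SemiringMult
import Algebra.Properties.Semiring.Sum as SemiringSum
import Algebra.Solver.Ring.NaturalCoefficients.Default as Solver
open import Data.Fin.Base as Fin using (Fin; zero; suc)
import Data.Fin.Properties as Fin
open import Data.Integer.Base as ℤ using (ℤ; 0ℤ; 1ℤ; ∣_∣; +_)
import Data.Integer.Properties as ℤ
open import Data.List.Base using (List; []; _∷_; _++_; map; foldr; filter; length; concatMap; allFin; tabulate; applyUpTo)
open import Data.List.Membership.Propositional using (_∈_; find; lose)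
open import Data.List.Membership.Propositional.Properties using (∈-map⁺; ∈-map⁻; ∈-++⁺ˡ; ∈-++⁺ʳ; ∈-++⁻; ∈-allFin; ∈-filter⁺; ∈-filter⁻; ∈-deduplicate⁻; ∈-cartesianProduct⁺; ∈-concat⁻′; ∈-concat⁺′)
import Data.List.Membership.Setoid as Membership
open import Data.List.Properties using (map-∘; length-map; length-++; length-tabulate)
open import Data.List.Relation.Binary.Disjoint.Propositional using (Disjoint)
open import Data.List.Relation.Unary.All as All using (All; []; _∷_)
import Data.List.Relation.Unary.All.Properties as All
open import Data.List.Relation.Unary.AllPairs as AllPairs using ([]; _∷_)
import Data.List.Relation.Unary.AllPairs.Properties as AllPairs
open import Data.List.Relation.Unary.Any as Any using (here; there; _─_)
import Data.List.Relation.Unary.Any.Properties as Any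
import Data.List.Relation.Unary.Unique.DecSetoid.Properties as DecUnique
open import Data.List.Relation.Unary.Unique.Propositional using (Unique)
import Data.List.Relation.Unary.Unique.Propositional.Properties as Unique
import Data.List.Relation.Unary.Unique.Setoid as UniqueSetoid
import Data.List.Relation.Unary.Unique.Setoid.Properties as UniqueSetoidProperties
open import Data.Nat using (ℕ; zero; suc; _∸_; _^_; _≤_; _<_; z≤n; s≤s) renaming (_*_ to _*ℕ_; _+_ to _+ℕ_)
open import Data.Nat.Combinatorics using (_C_; nCk+nC[k+1]≡[n+1]C[k+1]; k>n⇒nCk≡0)
open import Data.Nat.Induction using (<-rec)
import Data.Nat.Properties as ℕ
import Data.Nat.Tactic.RingSolver as ℕ-Solver
open import Data.Product using (_×_; _,_; ∃; proj₁; proj₂)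
open import Data.Sum.Base using (_⊎_; inj₁; inj₂)
open import Data.Unit.Polymorphic using (⊤; tt)
open import Data.Vec.Functional as Vector using (Vector)
open import Function.Base using (_∘_; id)
open import Level using (_⊔_)
open import Relation.Binary.Bundles using (DecPoset; Setoid)
open import Relation.Binary.PropositionalEquality as ≡ using (_≡_; _≢_)
import Relation.Binary.Reasoning.Setoid as SetoidReasoning
open import Relation.Binary.Structures using (IsStrictTotalOrder)
open import Relation.Nullary using (¬_; yes; no; contradiction)
open import Relation.Nullary.Decidable using (¬?; _×-dec_)
open import Relation.Unary as Unary using (Pred; _⊆_; _≐_)

-- Finite sums over lists in a commutative monoid

module ListSum {a ℓ} (M : CommutativeMonoid a ℓ) where

  open CommutativeMonoid M
  open MonoidMult monoid using () renaming (_×_ to _·_)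
  open SetoidReasoning setoid

  ∑ : ∀ {b} {B : Set b} → (B → Carrier) → List B → Carrier
  ∑ f xs = foldr _∙_ ε (map f xs)

  module _ {b} {B : Set b} where

    ∑-cong : ∀ {f g : B → Carrier} xs → (∀ {x} → x ∈ xs → f x ≈ g x) → ∑ f xs ≈ ∑ g xs
    ∑-cong []       e = refl
    ∑-cong (x ∷ xs) e = ∙-cong (e (here ≡.refl)) (∑-cong xs (e ∘ there))

    ∑-ε : ∀ {f : B → Carrier} xs → (∀ x → f x ≈ ε) → ∑ f xs ≈ ε
    ∑-ε []       e = refl
    ∑-ε (x ∷ xs) e = trans (∙-cong (e x) (∑-ε xs e)) (identityˡ ε)

    ∑-const : ∀ x (xs : List B) → ∑ (λ _ → x) xs ≈ length xs · x
    ∑-const x []       = refl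
    ∑-const x (_ ∷ xs) = ∙-congˡ (∑-const x xs)

    ∑-++ : ∀ (f : B → Carrier) xs ys → ∑ f (xs ++ ys) ≈ ∑ f xs ∙ ∑ f ys
    ∑-++ f []       ys = sym (identityˡ _)
    ∑-++ f (x ∷ xs) ys = trans (∙-congˡ (∑-++ f xs ys)) (sym (assoc _ _ _))

    ∑-map : ∀ {d} {D : Set d} (f : B → Carrier) (h : D → B) xs → ∑ f (map h xs) ≈ ∑ (λ x → f (h x)) xs
    ∑-map f h xs = reflexive (≡.cong (foldr _∙_ ε) (≡.sym (map-∘ xs)))

    ∑-concatMap : ∀ {d} {D : Set d} (f : B → Carrier) (h : D → List B) xs →
                  ∑ f (concatMap h xs) ≈ ∑ (λ x → ∑ f (h x)) xs
    ∑-concatMap f h []       = refl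
    ∑-concatMap f h (x ∷ xs) = trans (∑-++ f (h x) _) (∙-congˡ (∑-concatMap f h xs))

  module _ {b ℓ′} (S : Setoid b ℓ′) where

    open Setoid S using () renaming (Carrier to B; _≈_ to _≋_; sym to ≋-sym; trans to ≋-trans)
    open Membership S using () renaming (_∈_ to _∈ₛ_)
    open UniqueSetoid S using () renaming (Unique to Uniqueₛ)

    private
      ∑-─ : ∀ {f : B → Carrier} → (∀ {x y} → x ≋ y → f x ≈ f y) →
            ∀ {x ys} (p : x ∈ₛ ys) → ∑ f ys ≈ f x ∙ ∑ f (ys ─ p)
      ∑-─ f-cong (here x≋y) = ∙-congʳ (sym (f-cong x≋y))
      ∑-─ {f} f-cong {x} {y ∷ ys} (there p) = begin
        f y ∙ ∑ f ys               ≈⟨ ∙-congˡ (∑-─ f-cong p) ⟩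
        f y ∙ (f x ∙ ∑ f (ys ─ p)) ≈⟨ assoc _ _ _ ⟨
        f y ∙ f x ∙ ∑ f (ys ─ p)   ≈⟨ ∙-congʳ (comm _ _) ⟩
        f x ∙ f y ∙ ∑ f (ys ─ p)   ≈⟨ assoc _ _ _ ⟩
        f x ∙ (f y ∙ ∑ f (ys ─ p)) ∎

      ∈-─⁻ : ∀ {x y ys} (p : x ∈ₛ ys) → y ∈ₛ (ys ─ p) → y ∈ₛ ys
      ∈-─⁻ (here _)  q         = there q
      ∈-─⁻ (there p) (here e)  = here e
      ∈-─⁻ (there p) (there q) = there (∈-─⁻ p q)

      ∈-─⁺ : ∀ {x y ys} (p : x ∈ₛ ys) → y ∈ₛ ys → ¬ (y ≋ x) → y ∈ₛ (ys ─ p)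
      ∈-─⁺ (here x≋z) (here y≋z) y≉x = contradiction (≋-trans y≋z (≋-sym x≋z)) y≉x
      ∈-─⁺ (here _)   (there q)  y≉x = q
      ∈-─⁺ (there p)  (here e)   y≉x = here e
      ∈-─⁺ (there p)  (there q)  y≉x = there (∈-─⁺ p q y≉x)

      All-─ : ∀ {p} {P : B → Set p} {x ys} (q : x ∈ₛ ys) → All P ys → All P (ys ─ q)
      All-─ (here _)  (_ ∷ ps) = ps
      All-─ (there q) (p ∷ ps) = p ∷ All-─ q ps

      Unique-─ : ∀ {x ys} (p : x ∈ₛ ys) → Uniqueₛ ys → Uniqueₛ (ys ─ p)
      Unique-─ (here _)  (_ ∷ ys!)  = ys!
      Unique-─ (there p) (y∉ ∷ ys!) = All-─ p y∉ ∷ Unique-─ p ys!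

      ∉-─ : ∀ {x y ys} (p : x ∈ₛ ys) → Uniqueₛ ys → y ∈ₛ (ys ─ p) → ¬ (y ≋ x)
      ∉-─ (here x≋z) (z∉ ∷ _) y∈ y≋x = All.lookupWith (λ z≉w y≋w → z≉w (≋-trans (≋-sym (≋-trans y≋x x≋z)) y≋w)) z∉ y∈
      ∉-─ (there p) (z∉ ∷ _) (here y≋z) y≋x = All.lookupWith (λ z≉w x≋w → z≉w (≋-trans (≋-sym y≋z) (≋-trans y≋x x≋w))) z∉ p
      ∉-─ (there p) (_ ∷ ys!) (there q) y≋x = ∉-─ p ys! q y≋x

    -- Later moves sums from the list of flats to lists of codes. Induction on `xs`: the entry of
    -- `ys` matching the head is removed, and uniqueness of both lists keeps the remainders equal as
    -- sets.
    ∑-unique : ∀ {f : B → Carrier} → (∀ {x y} → x ≋ y → f x ≈ f y) →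
               ∀ {xs ys} → Uniqueₛ xs → Uniqueₛ ys →
               (∀ {x} → x ∈ₛ xs → x ∈ₛ ys) → (∀ {y} → y ∈ₛ ys → y ∈ₛ xs) → ∑ f xs ≈ ∑ f ys
    ∑-unique f-cong {[]} {[]}     _ _ _ _ = refl
    ∑-unique f-cong {[]} {y ∷ ys} _ _ _ ys⊆ with () ← ys⊆ (here (Setoid.refl S))
    ∑-unique {f} f-cong {x ∷ xs} {ys} (x∉ ∷ xs!) ys! xs⊆ ys⊆ = begin
      f x ∙ ∑ f xs       ≈⟨ ∙-congˡ (∑-unique f-cong xs! (Unique-─ p ys!) xs⊆′ ys⊆′) ⟩
      f x ∙ ∑ f (ys ─ p) ≈⟨ ∑-─ f-cong p ⟨
      ∑ f ys             ∎
      where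
      p : x ∈ₛ ys
      p = xs⊆ (here (Setoid.refl S))

      xs⊆′ : ∀ {y} → y ∈ₛ xs → y ∈ₛ (ys ─ p)
      xs⊆′ y∈ = ∈-─⁺ p (xs⊆ (there y∈)) λ y≋x →
        All.lookupWith (λ x≉w y≋w → x≉w (≋-trans (≋-sym y≋x) y≋w)) x∉ y∈

      ys⊆′ : ∀ {y} → y ∈ₛ (ys ─ p) → y ∈ₛ xs
      ys⊆′ y∈ with ys⊆ (∈-─⁻ p y∈)
      ... | here y≋x = contradiction y≋x (∉-─ p ys! y∈)
      ... | there q  = q

-- Invariance of the dimension of a subspace

module Dimension {c ℓ₁ ℓ₂} (K : OrderedField c ℓ₁ ℓ₂) where

  open OrderedField K hiding (zero)
  open Arrangements K
  open SemiringSum semiring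
  open SetoidReasoning setoid
  open IsBasis

  1≉0 : ¬ (1# ≈ 0#)
  1≉0 1≈0 = IsStrictTotalOrder.irrefl isStrictTotalOrder (sym 1≈0) 0≺1

  cut-dim : ∀ {m d} {S : List (LinearForm m)} (f : LinearForm m) {b : Vector (Point m) d}
            (isBasis : IsBasis b (⋂ S)) → d ≤ suc (proj₁ (cut f isBasis))
  cut-dim {d = zero}  f isBasis = z≤n
  cut-dim {d = suc d} f {b} isBasis with Fin.any? (λ i → ¬? (⟦ f ⟧ (b i) ≟ 0#))
  ... | yes _ = ℕ.≤-refl
  ... | no  _ = ℕ.n≤1+n _

  -- By `cut-dim` each form costs at most one dimension.
  dim-lower-bound : ∀ {m} (S : List (LinearForm m)) → m ≤ length S +ℕ dim S
  dim-lower-bound []      = ℕ.≤-refl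
  dim-lower-bound (f ∷ S) = ℕ.≤-trans (dim-lower-bound S)
    (ℕ.≤-trans (ℕ.+-monoʳ-≤ (length S) (cut-dim f (proj₂ (proj₂ (basis S)))))
               (ℕ.≤-reflexive (ℕ.+-suc (length S) _)))

  -- Coordinate `k` of a combination, as a form in the coefficients: the common zeros of all columns
  -- are the linear relations among the vectors `M i`.
  column : ∀ {d d′} → Vector (Point d) d′ → Fin d → LinearForm d′
  column M k = record
    { ⟦_⟧     = λ t → lincomb t M k
    ; ⟦⟧-cong = λ t≈t′ → sum-cong-≋ (λ i → *-congʳ (t≈t′ i))
    ; +-homo  = λ t t′ → trans (sum-cong-≋ (λ i → distribʳ (M i k) (t i) (t′ i)))
                               (∑-distrib-+ (λ i → t i * M i k) _)
    ; *-homo  = λ u t → trans (sum-cong-≋ (λ i → *-assoc u (t i) (M i k)))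
                              (sym (*-distribˡ-sum u (λ i → t i * M i k)))
    }

  -- The relations solve `d` equations in `d′` unknowns, so by `dim-lower-bound` their space has
  -- positive dimension; any vector of a basis of it will do.
  dependent : ∀ {d d′} → d < d′ → (M : Vector (Point d) d′) →
              ∃ λ t → ¬ (∀ i → t i ≈ 0#) × (∀ k → lincomb t M k ≈ 0#)
  dependent {d} {d′} d<d′ M =
    nonzero (basis S) (ℕ.+-cancelˡ-< d 0 (dim S)
      (ℕ.<-≤-trans (ℕ.≤-<-trans (ℕ.≤-reflexive (ℕ.+-identityʳ d)) d<d′)
        (≡.subst (λ l → d′ ≤ l +ℕ dim S) (length-tabulate (column M)) (dim-lower-bound S))))
    where
    S = tabulate (column M)

    nonzero : (β : ∃ λ e → ∃ λ (b : Vector (Point d′) e) → IsBasis b (⋂ S)) → 0 < proj₁ β →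
              ∃ λ t → ¬ (∀ i → t i ≈ 0#) × (∀ k → lincomb t M k ≈ 0#)
    nonzero (suc e , b , isBasis) _ = b zero , b₀≉0 , All.tabulate⁻ (inside isBasis zero)
      where
      b₀≉0 : ¬ (∀ i → b zero i ≈ 0#)
      -- If `b zero` vanished, the coefficients `δ zero` would be a nontrivial relation in a basis.
      b₀≉0 b₀≈0 = 1≉0 (independent isBasis (δ zero) (λ k → begin
        1# * b zero k + sum (λ i → 0# * b (suc i) k) ≈⟨ +-cong (*-identityˡ _) (sum-zero (λ i → 0# * b (suc i) k) (λ i → zeroˡ _)) ⟩
        b zero k + 0#                                   ≈⟨ +-identityʳ _ ⟩
        b zero k                                         ≈⟨ b₀≈0 k ⟩
        0#                                               ∎) zero)

  -- The rows of `M` expand `b` in terms of `b′`. If `d′ < d`, these rows satisfy a nontrivial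
  -- relation, and the vectors of `b` satisfy the same one.
  basis-size-≤ : ∀ {m d d′} {X X′ : Pred (Point m) _} {b : Vector (Point m) d} {b′ : Vector (Point m) d′} →
                 IsBasis b X → IsBasis b′ X′ → X ⊆ X′ → d ≤ d′
  basis-size-≤ {d = d} {d′} {b = b} {b′} isBasis isBasis′ X⊆X′ = ℕ.≮⇒≥ λ d′<d →
    let t , t≉0 , tM≈0 = dependent d′<d M in
    t≉0 (independent isBasis t (λ k → begin
      sum (λ i → t i * b i k)
        ≈⟨ sum-cong-≋ (λ i → *-congˡ (sym (proj₂ (spanning isBasis′ (X⊆X′ (inside isBasis i))) k))) ⟩
      sum (λ i → t i * sum (λ j → M i j * b′ j k))
        ≈⟨ sum-cong-≋ (λ i → *-distribˡ-sum (t i) (λ j → M i j * b′ j k)) ⟩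
      sum (λ i → sum (λ j → t i * (M i j * b′ j k)))
        ≈⟨ ∑-comm (λ i j → t i * (M i j * b′ j k)) ⟩
      sum (λ j → sum (λ i → t i * (M i j * b′ j k)))
        ≈⟨ sum-cong-≋ (λ j → sum-cong-≋ (λ i → sym (*-assoc (t i) (M i j) (b′ j k)))) ⟩
      sum (λ j → sum (λ i → t i * M i j * b′ j k))
        ≈⟨ sum-cong-≋ (λ j → sym (*-distribʳ-sum (b′ j k) (λ i → t i * M i j))) ⟩
      sum (λ j → lincomb t M j * b′ j k)
        ≈⟨ sum-zero _ (λ j → trans (*-congʳ (tM≈0 j)) (zeroˡ _)) ⟩
      0# ∎))
    where
    M : Vector (Point d′) d
    M i = proj₁ (spanning isBasis′ (X⊆X′ (inside isBasis i)))

  -- `dim` is read off from an elimination that follows the list `S`; this makes it depend on the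
  -- subspace alone.
  dim-unique : ∀ {m d} {X : Pred (Point m) _} {b : Vector (Point m) d} (S : List (LinearForm m)) →
               IsBasis b X → ⋂ S ≐ X → dim S ≡ d
  dim-unique S isBasis (S⊆X , X⊆S) =
    let _ , _ , isBasisˢ = basis S in
    ℕ.≤-antisym (basis-size-≤ isBasisˢ isBasis S⊆X) (basis-size-≤ isBasis isBasisˢ X⊆S)

-- Codes of flats and the flats below a given one

data Kind : Set where
  braid signed : Kind

-- The dimension of the minimum flat; sizes of codes below are counted from it.
base : Kind → ℕ
base braid  = 1
base signed = 0

-- The values 0, xᵢ and − xᵢ that a dependent coordinate can take.
data Atom : Kind → ℕ → Set where
  zer : ∀ {n} → Atom signed n
  pos : ∀ {k n} → Fin n → Atom k n
  neg : ∀ {n} → Fin n → Atom signed n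

rename : ∀ {k m n} → (Fin m → Fin n) → Atom k m → Atom k n
rename ρ zer     = zer
rename ρ (pos i) = pos (ρ i)
rename ρ (neg i) = neg (ρ i)

negate : ∀ {n} → Atom signed n → Atom signed n
negate zer     = zer
negate (pos i) = neg i
negate (neg i) = pos i

infixl 5 _>>=_
_>>=_ : ∀ {k m n} → Atom k m → (Fin m → Atom k n) → Atom k n
zer   >>= σ = zer
pos i >>= σ = σ i
neg i >>= σ = negate (σ i)

atoms : ∀ k n → List (Atom k n)
atoms braid  n = map pos (allFin n)
atoms signed n = zer ∷ map pos (allFin n) ++ map neg (allFin n)

∈-atoms : ∀ {k n} (a : Atom k n) → a ∈ atoms k n
∈-atoms          zer     = here ≡.refl
∈-atoms {braid}  (pos i) = ∈-map⁺ pos (∈-allFin i)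
∈-atoms {signed} (pos i) = there (∈-++⁺ˡ (∈-map⁺ pos (∈-allFin i)))
∈-atoms          (neg i) = there (∈-++⁺ʳ _ (∈-map⁺ neg (∈-allFin i)))

atoms-unique : ∀ k n → Unique (atoms k n)
atoms-unique braid  n = Unique.map⁺ (λ { ≡.refl → ≡.refl }) (Unique.allFin⁺ n)
atoms-unique signed n =
  All.++⁺ {xs = map pos (allFin n)} (All.map⁺ (All.tabulate λ _ ())) (All.map⁺ (All.tabulate λ _ ())) ∷
  Unique.++⁺ (Unique.map⁺ (λ { ≡.refl → ≡.refl }) (Unique.allFin⁺ n))
             (Unique.map⁺ (λ { ≡.refl → ≡.refl }) (Unique.allFin⁺ n))
             disjoint
  where
  disjoint : Disjoint {A = Atom signed n} (map pos (allFin n)) (map neg (allFin n))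
  disjoint (p , q) with _ , _ , ≡.refl ← ∈-map⁻ pos p with () ← proj₂ (proj₂ (∈-map⁻ neg q))

-- There are `c + base k` free coordinates to refer to. The `suc` counts the base coordinate in the
-- braid case and the value 0 in the signed case.
atomCount : Kind → ℕ → ℕ
atomCount braid  c = suc c
atomCount signed c = suc (c +ℕ c)

length-atoms : ∀ k c → length (atoms k (c +ℕ base k)) ≡ atomCount k c
length-atoms braid c = ≡.trans (length-map pos (allFin (c +ℕ 1))) (≡.trans (length-tabulate {n = c +ℕ 1} id) (ℕ.+-comm c 1))
length-atoms signed c rewrite ℕ.+-identityʳ c =
  ≡.cong suc (≡.trans (length-++ (map pos (allFin c)))
    (≡.cong₂ _+ℕ_ (≡.trans (length-map pos (allFin c)) (length-tabulate {n = c} id))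
                 (≡.trans (length-map neg (allFin c)) (length-tabulate {n = c} id))))

-- A flat of dimension c + base k in dimension m + base k. Coordinate 0 is the one added last, and
-- the atom in old refers to the free coordinates, located by rep.
data Code (k : Kind) : ℕ → ℕ → Set where
  nil : Code k 0 0
  new : ∀ {m c} → Code k m c → Code k (suc m) (suc c)
  old : ∀ {m c} → Atom k (c +ℕ base k) → Code k m c → Code k (suc m) c

Flat : Kind → ℕ → Set
Flat k m = ∃ (Code k m)

rep : ∀ {k m c} → Code k m c → Fin (c +ℕ base k) → Fin (m +ℕ base k)
rep nil       j       = j
rep (new X)   zero    = zero
rep (new X)   (suc j) = suc (rep X j)
rep (old a X) j       = suc (rep X j)

-- The normal form of coordinate `i` on the flat, as an atom in the free coordinates.
eval : ∀ {k m c} → Code k m c → Fin (m +ℕ base k) → Atom k (c +ℕ base k)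
eval nil       i       = pos i
eval (new X)   zero    = pos zero
eval (new X)   (suc i) = rename suc (eval X i)
eval (old a X) zero    = a
eval (old a X) (suc i) = eval X i

eval-rep : ∀ {k m c} (X : Code k m c) j → eval X (rep X j) ≡ pos j
eval-rep nil       j       = ≡.refl
eval-rep (new X)   zero    = ≡.refl
eval-rep (new X)   (suc j) = ≡.cong (rename suc) (eval-rep X j)
eval-rep (old a X) j       = eval-rep X j

-- Shows that `putFlat (rename (rep X) a)` sends `X` to `old a X`, which is how a flat is recognised
-- in its own list `below`.
rename-rep->>=-eval : ∀ {k m c} (X : Code k m c) a → rename (rep X) a >>= eval X ≡ a
rename-rep->>=-eval X zer     = ≡.refl
rename-rep->>=-eval X (pos j) = eval-rep X j
rename-rep->>=-eval X (neg j) = ≡.cong negate (eval-rep X j)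

-- Here `a` may refer to any coordinate, while `old` admits only free ones; `eval X` rewrites it
-- accordingly.
put : ∀ {k m c} → Atom k (m +ℕ base k) → Code k m c → Code k (suc m) c
put a X = old (a >>= eval X) X

code-dim-≤ : ∀ {k m c} → Code k m c → c ≤ m
code-dim-≤ nil       = z≤n
code-dim-≤ (new X)   = s≤s (code-dim-≤ X)
code-dim-≤ (old a X) = ℕ.m≤n⇒m≤1+n (code-dim-≤ X)

top : ∀ {k} m → Code k m m
top zero    = nil
top (suc m) = new (top m)

extensions : ∀ {k m} → Flat k m → List (Flat k (suc m))
extensions {k} (c , X) = (suc c , new X) ∷ map (λ a → c , old a X) (atoms k (c +ℕ base k))

putFlat : ∀ {k m} → Atom k (m +ℕ base k) → Flat k m → Flat k (suc m)
putFlat a (c , X) = c , put a X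

-- All flats contained in the given one.
below : ∀ {k m c} → Code k m c → List (Flat k m)
below nil       = (_ , nil) ∷ []
below (new X)   = concatMap extensions (below X)
below (old a X) = map (putFlat (rename (rep X) a)) (below X)

restrict : ∀ {k m} → Flat k (suc m) → Flat k m
restrict (_ , new X)   = _ , X
restrict (_ , old a X) = _ , X

restrict-extensions : ∀ {k m} {Y : Flat k (suc m)} (X : Flat k m) → Y ∈ extensions X → restrict Y ≡ X
restrict-extensions X (here ≡.refl) = ≡.refl
restrict-extensions (c , X) (there Y∈) with _ , _ , ≡.refl ← ∈-map⁻ (λ a → c , old a X) Y∈ = ≡.refl

∈-extensions : ∀ {k m} (Y : Flat k (suc m)) → Y ∈ extensions (restrict Y)
∈-extensions (_ , new X)   = here ≡.refl
∈-extensions (_ , old a X) = there (∈-map⁺ _ (∈-atoms a))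

extensions-unique : ∀ {k m} (X : Flat k m) → Unique (extensions X)
extensions-unique {k} (c , X) =
  All.map⁺ (All.tabulate λ _ ()) ∷ Unique.map⁺ (λ { ≡.refl → ≡.refl }) (atoms-unique k (c +ℕ base k))

extensions-disjoint : ∀ {k m} {X Y : Flat k m} → X ≢ Y → Disjoint (extensions X) (extensions Y)
extensions-disjoint {X = X} {Y} X≢Y (Z∈ , Z∈′) =
  X≢Y (≡.trans (≡.sym (restrict-extensions X Z∈)) (restrict-extensions Y Z∈′))

-- `restrict` recovers the flat that was extended: extensions of different flats are disjoint, and
-- `putFlat` with a fixed atom is injective.
below-unique : ∀ {k m c} (X : Code k m c) → Unique (below X)
below-unique nil       = [] ∷ []
below-unique (new X)   = Unique.concat⁺
  (All.map⁺ (All.tabulate λ {Y} _ → extensions-unique Y))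
  (AllPairs.map⁺ (AllPairs.map extensions-disjoint (below-unique X)))
below-unique (old a X) = Unique.map⁺ {f = putFlat (rename (rep X) a)} (≡.cong restrict) (below-unique X)

∈-below-new⁻ : ∀ {k m c} (X : Code k m c) {Y} → Y ∈ below (new X) → restrict Y ∈ below X
∈-below-new⁻ X Y∈ with ∈-concat⁻′ (map extensions (below X)) Y∈
... | _ , Y∈ys , ys∈ with Z , Z∈ , ≡.refl ← ∈-map⁻ extensions ys∈ =
  ≡.subst (_∈ below X) (≡.sym (restrict-extensions Z Y∈ys)) Z∈

∈-below-new⁺ : ∀ {k m c} (X : Code k m c) {Y} → restrict Y ∈ below X → Y ∈ below (new X)
∈-below-new⁺ X {Y} Y′∈ = ∈-concat⁺′ (∈-extensions Y) (∈-map⁺ extensions Y′∈)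

below-top : ∀ {k m} (Y : Flat k m) → Y ∈ below (top m)
below-top {m = zero}  (_ , nil) = here ≡.refl
below-top {m = suc m} Y         = ∈-below-new⁺ (top m) (below-top (restrict Y))

-- Dimension is strictly monotone on the lists `below`. This yields antisymmetry for codes and the
-- induction that computes the Möbius function.
below-dim : ∀ {k m c} (X : Code k m c) {Y} → Y ∈ below X → (proj₁ Y < c) ⊎ (Y ≡ (c , X))
below-dim nil (here ≡.refl) = inj₂ ≡.refl
below-dim (new X) {_ , new Y} Y∈ with below-dim X (∈-below-new⁻ X Y∈)
... | inj₁ d<c    = inj₁ (s≤s d<c)
... | inj₂ ≡.refl = inj₂ ≡.refl
below-dim (new X) {_ , old a Y} Y∈ with below-dim X (∈-below-new⁻ X Y∈)
... | inj₁ d<c    = inj₁ (ℕ.m≤n⇒m≤1+n d<c)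
-- Binding the coordinate that is free in `new X` costs exactly one dimension.
... | inj₂ ≡.refl = inj₁ ℕ.≤-refl
below-dim (old a X) Y∈ with Y′ , Y′∈ , ≡.refl ← ∈-map⁻ (putFlat (rename (rep X) a)) Y∈ with below-dim X Y′∈
... | inj₁ d<c    = inj₁ d<c
... | inj₂ ≡.refl = inj₂ (≡.cong (λ a → _ , old a X) (rename-rep->>=-eval X a))

atom₀ : ∀ {k} → Atom k (base k)
atom₀ {braid}  = pos zero
atom₀ {signed} = zer

-- With one coordinate and no signs, or with no coordinate at all, only one value can be written
-- down. Hence every equation between atoms holds at the base.
atom-unique : ∀ {k} (a : Atom k (base k)) → a ≡ atom₀
atom-unique         zer        = ≡.refl
atom-unique {braid} (pos zero) = ≡.refl

bot : ∀ {k} m → Code k m 0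
bot zero    = nil
bot (suc m) = old atom₀ (bot m)

-- Codes as linear subspaces

module Semantics {c ℓ₁ ℓ₂} (K : OrderedField c ℓ₁ ℓ₂) where

  open OrderedField K hiding (zero)
  open Arrangements K
  open Dimension K
  open RingProperties ring using (-0#≈0#; -‿involutive; -‿injective; +-cancelʳ)
  open SemiringSum semiring
  open SetoidReasoning setoid

  -- The order gives 0 < 1 < 1 + 1, which excludes characteristic 2, where `pos i` and `neg i` would
  -- have the same values.
  1≉-1 : ¬ (1# ≈ - 1#)
  1≉-1 1≈-1 = irrefl refl (≺-trans 0≺1 (<-resp-≈ .proj₁ 1+1≈0 (<-resp-≈ .proj₂ (+-identityʳ 1#) (+-monoʳ-≺ 1# 0≺1))))
    where
    open IsStrictTotalOrder isStrictTotalOrder using (irrefl; <-resp-≈) renaming (trans to ≺-trans)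
    1+1≈0 : 1# + 1# ≈ 0#
    1+1≈0 = trans (+-congˡ 1≈-1) (-‿inverseʳ 1#)

  ⟪_⟫ : ∀ {k n} → Atom k n → Point n → Carrier
  ⟪ zer   ⟫ x = 0#
  ⟪ pos i ⟫ x = x i
  ⟪ neg i ⟫ x = - x i

  ⟪⟫-cong : ∀ {k n} (a : Atom k n) {x y} → (∀ i → x i ≈ y i) → ⟪ a ⟫ x ≈ ⟪ a ⟫ y
  ⟪⟫-cong zer     x≈y = refl
  ⟪⟫-cong (pos i) x≈y = x≈y i
  ⟪⟫-cong (neg i) x≈y = -‿cong (x≈y i)

  ⟪⟫-rename : ∀ {k m n} (ρ : Fin m → Fin n) (a : Atom k m) x → ⟪ rename ρ a ⟫ x ≡ ⟪ a ⟫ (x ∘ ρ)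
  ⟪⟫-rename ρ zer     x = ≡.refl
  ⟪⟫-rename ρ (pos i) x = ≡.refl
  ⟪⟫-rename ρ (neg i) x = ≡.refl

  ⟪⟫-negate : ∀ {n} (a : Atom signed n) x → ⟪ negate a ⟫ x ≈ - ⟪ a ⟫ x
  ⟪⟫-negate zer     x = sym -0#≈0#
  ⟪⟫-negate (pos i) x = refl
  ⟪⟫-negate (neg i) x = sym (-‿involutive _)

  ⟪⟫->>= : ∀ {k m n} (a : Atom k m) (σ : Fin m → Atom k n) x → ⟪ a >>= σ ⟫ x ≈ ⟪ a ⟫ (λ i → ⟪ σ i ⟫ x)
  ⟪⟫->>= zer     σ x = refl
  ⟪⟫->>= (pos i) σ x = refl
  ⟪⟫->>= (neg i) σ x = ⟪⟫-negate (σ i) x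

  ⟪⟫-lincomb : ∀ {k n} (a : Atom k n) (t : Point n) → sum (λ j → t j * ⟪ a ⟫ (δ j)) ≈ ⟪ a ⟫ t
  ⟪⟫-lincomb zer     t = sum-zero (λ j → t j * 0#) (λ j → zeroʳ (t j))
  ⟪⟫-lincomb (pos i) t = lincomb-δ t i
  ⟪⟫-lincomb (neg i) t = trans (sym (form-lincomb (⊖ coord i) t δ)) (-‿cong (lincomb-δ t i))

  δ-diagonal : ∀ {n} (i : Fin n) → δ i i ≡ 1#
  δ-diagonal zero    = ≡.refl
  δ-diagonal (suc i) = δ-diagonal i

  δ≈1⇒≡ : ∀ {n} (i j : Fin n) → δ i j ≈ 1# → i ≡ j
  δ≈1⇒≡ zero    zero    e = ≡.refl
  δ≈1⇒≡ zero    (suc j) e = contradiction (sym e) 1≉0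
  δ≈1⇒≡ (suc i) zero    e = contradiction (sym e) 1≉0
  δ≈1⇒≡ (suc i) (suc j) e = ≡.cong suc (δ≈1⇒≡ i j e)

  -- The point with all coordinates 1 separates the three constructors, and the points `δ i`
  -- separate the indices.
  ⟪⟫-injective : ∀ {k n} (a b : Atom k n) → (∀ x → ⟪ a ⟫ x ≈ ⟪ b ⟫ x) → a ≡ b
  ⟪⟫-injective zer     zer     e = ≡.refl
  ⟪⟫-injective zer     (pos j) e = contradiction (sym (e (λ _ → 1#))) 1≉0
  ⟪⟫-injective zer     (neg j) e = contradiction (-‿injective (trans (sym (e (λ _ → 1#))) (sym -0#≈0#))) 1≉0
  ⟪⟫-injective (pos i) zer     e = contradiction (e (λ _ → 1#)) 1≉0
  ⟪⟫-injective (pos i) (pos j) e = ≡.cong pos (δ≈1⇒≡ i j (trans (sym (e (δ i))) (reflexive (δ-diagonal i))))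
  ⟪⟫-injective (pos i) (neg j) e = contradiction (e (λ _ → 1#)) 1≉-1
  ⟪⟫-injective (neg i) zer     e = contradiction (-‿injective (trans (e (λ _ → 1#)) (sym -0#≈0#))) 1≉0
  ⟪⟫-injective (neg i) (pos j) e = contradiction (sym (e (λ _ → 1#))) 1≉-1
  ⟪⟫-injective (neg i) (neg j) e = ≡.cong neg (δ≈1⇒≡ i j (trans (sym (-‿injective (e (δ i)))) (reflexive (δ-diagonal i))))

  -- The point set of a code by recursion on the code, which suits inductions better than a list of
  -- forms; `Sat⇒⋂` and `⋂⇒Sat` translate between the two.
  Sat : ∀ {k m d} → Code k m d → Point (m +ℕ base k) → Set ℓ₁
  Sat nil       x = ⊤
  Sat (new X)   x = Sat X (x ∘ suc)
  Sat (old a X) x = (x zero ≈ ⟪ a ⟫ (x ∘ suc ∘ rep X)) × Sat X (x ∘ suc)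

  Sat-eval : ∀ {k m d} (X : Code k m d) {x} → Sat X x → ∀ i → x i ≈ ⟪ eval X i ⟫ (x ∘ rep X)
  Sat-eval nil       _        i       = refl
  Sat-eval (new X)   _        zero    = refl
  Sat-eval (new X) {x} Xx     (suc i) = trans (Sat-eval X Xx i) (reflexive (≡.sym (⟪⟫-rename suc (eval X i) (x ∘ rep (new X)))))
  Sat-eval (old a X) (e , _)  zero    = e
  Sat-eval (old a X) (_ , Xx) (suc i) = Sat-eval X Xx i

  Sat-atom : ∀ {k m d} (X : Code k m d) {x} → Sat X x → ∀ a → ⟪ a ⟫ x ≈ ⟪ a >>= eval X ⟫ (x ∘ rep X)
  Sat-atom X {x} Xx a = trans (⟪⟫-cong a (Sat-eval X Xx)) (sym (⟪⟫->>= a (eval X) (x ∘ rep X)))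

  Sat-put⁺ : ∀ {k m d} (X : Code k m d) a {x} → x zero ≈ ⟪ a ⟫ (x ∘ suc) → Sat X (x ∘ suc) → Sat (put a X) x
  Sat-put⁺ X a e Xx = trans e (Sat-atom X Xx a) , Xx

  Sat-put⁻ : ∀ {k m d} (X : Code k m d) a {x} → Sat (put a X) x → x zero ≈ ⟪ a ⟫ (x ∘ suc) × Sat X (x ∘ suc)
  Sat-put⁻ X a (e , Xx) = trans e (sym (Sat-atom X Xx a)) , Xx

  -- Parametrises the flat by its free coordinates; on the flat it inverts the projection
  -- `_∘ rep X`.
  point : ∀ {k m d} → Code k m d → Point (d +ℕ base k) → Point (m +ℕ base k)
  point nil       y = y
  point (new X)   y = y zero Vector.∷ point X (y ∘ suc)
  point (old a X) y = ⟪ a ⟫ y Vector.∷ point X y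

  point-rep : ∀ {k m d} (X : Code k m d) y j → point X y (rep X j) ≡ y j
  point-rep nil       y j       = ≡.refl
  point-rep (new X)   y zero    = ≡.refl
  point-rep (new X)   y (suc j) = point-rep X (y ∘ suc) j
  point-rep (old a X) y j       = point-rep X y j

  Sat-point : ∀ {k m d} (X : Code k m d) y → Sat X (point X y)
  Sat-point nil       y = tt
  Sat-point (new X)   y = Sat-point X (y ∘ suc)
  Sat-point (old a X) y = ⟪⟫-cong a (λ j → reflexive (≡.sym (point-rep X y j))) , Sat-point X y

  point-eval : ∀ {k m d} (X : Code k m d) y i → point X y i ≈ ⟪ eval X i ⟫ y
  point-eval X y i = trans (Sat-eval X (Sat-point X y) i) (⟪⟫-cong (eval X i) (λ j → reflexive (point-rep X y j)))

  -- Codes as intersections of hyperplanes of the arrangement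

  𝒜 : ∀ (k : Kind) n → Arrangement n
  𝒜 braid  = 𝓐
  𝒜 signed = 𝓑

  Relation : Kind → ℕ → Set
  Relation k n = Fin n × Atom k n

  shift : ∀ {k n} → Relation k n → Relation k (suc n)
  shift (i , a) = suc i , rename suc a

  form : ∀ {k n} → Relation k n → LinearForm n
  form (i , zer)   = coord i
  form (i , pos j) = coord i ⊕ (⊖ coord j)
  form (i , neg j) = coord i ⊕ coord j

  form⁺ : ∀ {k n} i (a : Atom k n) {x} → x i ≈ ⟪ a ⟫ x → ⟦ form (i , a) ⟧ x ≈ 0#
  form⁺ i zer     e = e
  form⁺ i (pos j) e = trans (+-congʳ e) (-‿inverseʳ _)
  form⁺ i (neg j) e = trans (+-congʳ e) (-‿inverseˡ _)

  form⁻ : ∀ {k n} i (a : Atom k n) {x} → ⟦ form (i , a) ⟧ x ≈ 0# → x i ≈ ⟪ a ⟫ x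
  form⁻ i zer         e = e
  form⁻ i (pos j) {x} e = +-cancelʳ (- x j) _ _ (trans e (sym (-‿inverseʳ _)))
  form⁻ i (neg j) {x} e = +-cancelʳ (x j) _ _ (trans e (sym (-‿inverseˡ _)))

  form-shift : ∀ {k n} (r : Relation k n) x → ⟦ form (shift r) ⟧ x ≡ ⟦ form r ⟧ (x ∘ suc)
  form-shift (i , zer)   x = ≡.refl
  form-shift (i , pos j) x = ≡.refl
  form-shift (i , neg j) x = ≡.refl

  relations : ∀ {k m d} → Code k m d → List (Relation k (m +ℕ base k))
  relations nil       = []
  relations (new X)   = map shift (relations X)
  relations (old a X) = (zero , rename (suc ∘ rep X) a) ∷ map shift (relations X)

  forms : ∀ {k m} → Flat k m → List (LinearForm (m +ℕ base k))
  forms (_ , X) = map form (relations X)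

  module _ {k n} {rs : List (Relation k n)} {x : Point (suc n)} where

    ⋂-shift⁺ : ⋂ (map form rs) (x ∘ suc) → ⋂ (map form (map shift rs)) x
    ⋂-shift⁺ p = All.map⁺ (All.map⁺ (All.map (λ {r} e → trans (reflexive (form-shift r x)) e) (All.map⁻ p)))

    ⋂-shift⁻ : ⋂ (map form (map shift rs)) x → ⋂ (map form rs) (x ∘ suc)
    ⋂-shift⁻ p = All.map⁺ (All.map (λ {r} e → trans (reflexive (≡.sym (form-shift r x))) e) (All.map⁻ (All.map⁻ p)))

  Sat⇒⋂ : ∀ {k m d} (X : Code k m d) {x} → Sat X x → ⋂ (forms (_ , X)) x
  Sat⇒⋂ nil       _        = []
  Sat⇒⋂ (new X)   Xx       = ⋂-shift⁺ (Sat⇒⋂ X Xx)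
  Sat⇒⋂ (old a X) {x} (e , Xx) =
    form⁺ zero (rename (suc ∘ rep X) a) (trans e (reflexive (≡.sym (⟪⟫-rename (suc ∘ rep X) a x)))) ∷ ⋂-shift⁺ (Sat⇒⋂ X Xx)

  ⋂⇒Sat : ∀ {k m d} (X : Code k m d) {x} → ⋂ (forms (_ , X)) x → Sat X x
  ⋂⇒Sat nil       _       = tt
  ⋂⇒Sat (new X)   p       = ⋂⇒Sat X (⋂-shift⁻ p)
  ⋂⇒Sat (old a X) {x} (e ∷ p) =
    trans (form⁻ zero (rename (suc ∘ rep X) a) e) (reflexive (⟪⟫-rename (suc ∘ rep X) a x)) , ⋂⇒Sat X (⋂-shift⁻ p)

  -- The arrangement contains the hyperplanes of two coordinates only with the smaller index first,
  -- so `form r` is a member of it under this condition.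
  Ordered : ∀ {k n} → Relation k n → Set
  Ordered (i , zer)   = ⊤
  Ordered (i , pos j) = i Fin.< j
  Ordered (i , neg j) = i Fin.< j

  Ordered-shift : ∀ {k n} (r : Relation k n) → Ordered r → Ordered (shift r)
  Ordered-shift (i , zer)   _   = tt
  Ordered-shift (i , pos j) i<j = s≤s i<j
  Ordered-shift (i , neg j) i<j = s≤s i<j

  Ordered-zero : ∀ {k m n} (ρ : Fin m → Fin n) (a : Atom k m) → Ordered {n = suc n} (zero , rename (suc ∘ ρ) a)
  Ordered-zero ρ zer     = tt
  Ordered-zero ρ (pos j) = s≤s z≤n
  Ordered-zero ρ (neg j) = s≤s z≤n

  -- Coordinates are added at index 0, so a dependent coordinate has a smaller index than the free
  -- coordinate to which it refers.
  relations-ordered : ∀ {k m d} (X : Code k m d) → All Ordered (relations X)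
  relations-ordered nil       = []
  relations-ordered (new X)   = All.map⁺ (All.map (λ {r} → Ordered-shift r) (relations-ordered X))
  relations-ordered (old a X) = Ordered-zero (rep X) a ∷ All.map⁺ (All.map (λ {r} → Ordered-shift r) (relations-ordered X))

  ∈-pairs : ∀ {n} {i j : Fin n} → i Fin.< j → (i , j) ∈ pairs n
  ∈-pairs i<j = ∈-filter⁺ (λ (i , j) → i Fin.<? j) (∈-cartesianProduct⁺ (∈-allFin _) (∈-allFin _)) i<j

  form∈𝒜 : ∀ {k n} (r : Relation k n) → Ordered r → form r ∈ 𝒜 k n
  form∈𝒜 {signed} {n} (i , zer) _ =
    ∈-++⁺ʳ (map (λ (i , j) → coord i ⊕ (⊖ coord j)) (pairs n))
      (∈-++⁺ʳ (map (λ (i , j) → coord i ⊕ coord j) (pairs n)) (∈-map⁺ coord (∈-allFin i)))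
  form∈𝒜 {braid} (i , pos j) i<j = ∈-map⁺ (λ (i , j) → coord i ⊕ (⊖ coord j)) (∈-pairs i<j)
  form∈𝒜 {signed} (i , pos j) i<j = ∈-++⁺ˡ (∈-map⁺ (λ (i , j) → coord i ⊕ (⊖ coord j)) (∈-pairs i<j))
  form∈𝒜 {signed} {n} (i , neg j) i<j =
    ∈-++⁺ʳ (map (λ (i , j) → coord i ⊕ (⊖ coord j)) (pairs n))
      (∈-++⁺ˡ (∈-map⁺ (λ (i , j) → coord i ⊕ coord j) (∈-pairs i<j)))

  𝒜⇒form : ∀ k {n} {f : LinearForm n} → f ∈ 𝒜 k n → ∃ λ (r : Relation k n) → f ≡ form r
  𝒜⇒form braid f∈ with (i , j) , _ , ≡.refl ← ∈-map⁻ _ f∈ = (i , pos j) , ≡.refl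
  𝒜⇒form signed {n} f∈ with ∈-++⁻ (map (λ (i , j) → coord i ⊕ (⊖ coord j)) (pairs n)) f∈
  ... | inj₁ f∈₁ with (i , j) , _ , ≡.refl ← ∈-map⁻ _ f∈₁ = (i , pos j) , ≡.refl
  ... | inj₂ f∈₂ with ∈-++⁻ (map (λ (i , j) → coord i ⊕ coord j) (pairs n)) f∈₂
  ...   | inj₁ f∈₃ with (i , j) , _ , ≡.refl ← ∈-map⁻ _ f∈₃ = (i , neg j) , ≡.refl
  ...   | inj₂ f∈₃ with i , _ , ≡.refl ← ∈-map⁻ coord f∈₃ = (i , zer) , ≡.refl

  forms∈𝒜 : ∀ {k m} (X : Flat k m) → All (_∈ 𝒜 k (m +ℕ base k)) (forms X)
  forms∈𝒜 (_ , X) = All.map⁺ (All.map (λ {r} → form∈𝒜 r) (relations-ordered X))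

  -- The unit vectors of the parameter space are carried over by `point`. Coefficients are read off
  -- at the free coordinates, which gives both spanning and independence.
  code-isBasis : ∀ {k m d} (X : Code k m d) → IsBasis (λ j → point X (δ j)) (⋂ (forms (_ , X)))
  code-isBasis {d = d} X = record
    { inside      = λ j → Sat⇒⋂ X (Sat-point X (δ j))
    ; spanning    = λ {x} Xx → x ∘ rep X , λ i →
        trans (lincomb-point (x ∘ rep X) i) (sym (Sat-eval X (⋂⇒Sat X Xx) i))
    ; independent = λ t t≈0 j → begin
        t j                                     ≡⟨ ≡.cong (λ a → ⟪ a ⟫ t) (eval-rep X j) ⟨
        ⟪ eval X (rep X j) ⟫ t                  ≈⟨ lincomb-point t (rep X j) ⟨
        lincomb t (λ j → point X (δ j)) (rep X j) ≈⟨ t≈0 (rep X j) ⟩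
        0#                                      ∎
    }
    where
    lincomb-point : ∀ t i → lincomb t (λ j → point X (δ j)) i ≈ ⟪ eval X i ⟫ t
    lincomb-point t i = trans (sum-cong-≋ (λ j → *-congˡ (point-eval X (δ j) i))) (⟪⟫-lincomb (eval X i) t)

  dim-code : ∀ {k m} (X : Flat k m) (S : List (LinearForm (m +ℕ base k))) → ⋂ S ≐ ⋂ (forms X) → dim S ≡ proj₁ X +ℕ base k
  dim-code (_ , X) S = dim-unique S (code-isBasis X)

  below-sound : ∀ {k m d} (X : Code k m d) {Y} → Y ∈ below X → ∀ {x} → Sat (proj₂ Y) x → Sat X x
  below-sound nil Y∈ Yx = tt
  below-sound (new X) {_ , new Y}   Y∈ Yx = below-sound X (∈-below-new⁻ X Y∈) Yx
  below-sound (new X) {_ , old a Y} Y∈ Yx = below-sound X (∈-below-new⁻ X Y∈) (proj₂ Yx)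
  below-sound (old a X) Y∈ {x} Yx with (_ , Y) , Y∈′ , ≡.refl ← ∈-map⁻ (putFlat (rename (rep X) a)) Y∈ =
    let e , Yx′ = Sat-put⁻ Y (rename (rep X) a) {x} Yx in
    trans e (reflexive (⟪⟫-rename (rep X) a (x ∘ suc))) , below-sound X Y∈′ Yx′

  below-complete : ∀ {k m d} (X : Code k m d) Y → (∀ {x} → Sat (proj₂ Y) x → Sat X x) → Y ∈ below X
  below-complete nil (_ , nil) Y⊆X = here ≡.refl
  below-complete (new X) (_ , new Y) Y⊆X =
    ∈-below-new⁺ X (below-complete X (_ , Y) λ {x} Yx → Y⊆X {0# Vector.∷ x} Yx)
  below-complete (new X) (_ , old a Y) Y⊆X =
    ∈-below-new⁺ X (below-complete X (_ , Y) λ {x} Yx → Y⊆X {⟪ a ⟫ (x ∘ rep Y) Vector.∷ x} (refl , Yx))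
  below-complete (old a X) (_ , new Y) Y⊆X =
    -- `new Y` contains two points that differ only in coordinate 0, whereas `old a X` determines
    -- that coordinate from the others.
    contradiction (trans (proj₁ (Y⊆X {1# Vector.∷ p} Yp)) (sym (proj₁ (Y⊆X {0# Vector.∷ p} Yp)))) 1≉0
    where
    p = point Y (λ _ → 0#)
    Yp = Sat-point Y (λ _ → 0#)
  below-complete {k} (old a X) (_ , old b Y) Y⊆X =
    ≡.subst (λ b → (_ , old b Y) ∈ below (old a X)) (≡.sym (⟪⟫-injective b b′ b≈b′))
      (∈-map⁺ (putFlat (rename (rep X) a))
        (below-complete X (_ , Y) λ {x} Yx → proj₂ (Y⊆X {⟪ b ⟫ (x ∘ rep Y) Vector.∷ x} (refl , Yx))))
    where
    b′ = rename (rep X) a >>= eval Y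
    -- On `Y` the atoms `b` and `a` must prescribe the same coordinate 0. Compared as functions of
    -- the free coordinates of `Y`, they give equal atoms by `⟪⟫-injective`.
    b≈b′ : ∀ y → ⟪ b ⟫ y ≈ ⟪ b′ ⟫ y
    b≈b′ y = begin
      ⟪ b ⟫ y                                ≈⟨ proj₁ (Y⊆X {⟪ b ⟫ y Vector.∷ point Y y} (Sat-point (old b Y) y)) ⟩
      ⟪ a ⟫ (point Y y ∘ rep X)              ≡⟨ ⟪⟫-rename (rep X) a (point Y y) ⟨
      ⟪ rename (rep X) a ⟫ (point Y y)       ≈⟨ Sat-atom Y (Sat-point Y y) (rename (rep X) a) ⟩
      ⟪ b′ ⟫ (point Y y ∘ rep Y)             ≈⟨ ⟪⟫-cong b′ (λ j → reflexive (point-rep Y y j)) ⟩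
      ⟪ b′ ⟫ y                               ∎

  forms-⊆⇒below : ∀ {k m} (Y X : Flat k m) → ⋂ (forms Y) ⊆ ⋂ (forms X) → Y ∈ below (proj₂ X)
  forms-⊆⇒below (_ , Y) (_ , X) Y⊆X = below-complete X (_ , Y) λ Yx → ⋂⇒Sat X (Y⊆X (Sat⇒⋂ Y Yx))

  below⇒forms-⊆ : ∀ {k m} (Y X : Flat k m) → Y ∈ below (proj₂ X) → ⋂ (forms Y) ⊆ ⋂ (forms X)
  below⇒forms-⊆ (_ , Y) (_ , X) Y∈ Yx = Sat⇒⋂ X (below-sound X Y∈ (⋂⇒Sat Y Yx))

  -- Each flat lies in the list `below` of the other; if they differed, `below-dim` would make both
  -- dimensions strictly smaller than each other.
  forms-injective : ∀ {k m} {Y X : Flat k m} → ⋂ (forms Y) ≐ ⋂ (forms X) → Y ≡ X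
  forms-injective {Y = Y} {X} (Y⊆X , X⊆Y)
    with below-dim (proj₂ X) (forms-⊆⇒below Y X Y⊆X) | below-dim (proj₂ Y) (forms-⊆⇒below X Y X⊆Y)
  ... | inj₂ Y≡X | _        = Y≡X
  ... | _        | inj₂ X≡Y = ≡.sym X≡Y
  ... | inj₁ <   | inj₁ >   = contradiction > (ℕ.<-asym <)

  -- Closure of the coded flats under intersection

  Meet : ∀ {k m} → Flat k m → Pred (Point (m +ℕ base k)) ℓ₁ → Set _
  Meet {k} {m} (_ , X) Q = ∃ λ (Z : Flat k m) → ∀ x →
    (Sat (proj₂ Z) x → Sat X x × Q x) × (Sat X x → Q x → Sat (proj₂ Z) x)

  -- Since `neg` exists only for `signed`, `head⁻` carries an equation on the kind; this keeps the
  -- family defined for every kind.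
  data Split {k n} : Atom k (suc n) → Set where
    tail  : ∀ a → Split (rename suc a)
    head⁺ : Split (pos zero)
    head⁻ : (eq : k ≡ signed) → Split (≡.subst (λ k → Atom k (suc n)) (≡.sym eq) (neg zero))

  split : ∀ {k n} (a : Atom k (suc n)) → Split a
  split zer           = tail zer
  split (pos zero)    = head⁺
  split (pos (suc i)) = tail (pos i)
  split (neg zero)    = head⁻ ≡.refl
  split (neg (suc i)) = tail (neg i)

  -- The three shapes of an equation between atoms, seen from coordinate 0: vacuous, free of that
  -- coordinate, or solved for it.
  data Reduced {n} (k : Kind) (Q : Pred (Point (suc n)) ℓ₁) : Set (c ⊔ ℓ₁) where
    always : (∀ x → Q x) → Reduced k Q
    tails  : ∀ (a b : Atom k n) → (∀ x → (⟪ a ⟫ (x ∘ suc) ≈ ⟪ b ⟫ (x ∘ suc) → Q x) ×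
                                        (Q x → ⟪ a ⟫ (x ∘ suc) ≈ ⟪ b ⟫ (x ∘ suc))) → Reduced k Q
    heads  : ∀ (b : Atom k n) → (∀ x → (x zero ≈ ⟪ b ⟫ (x ∘ suc) → Q x) ×
                                      (Q x → x zero ≈ ⟪ b ⟫ (x ∘ suc))) → Reduced k Q

  -- 2 is invertible by `1≉-1`, and twice `x` is 0. Thus the equation between `pos zero` and
  -- `neg zero` is solved by the value 0.
  x≈-x⇒x≈0 : ∀ x → x ≈ - x → x ≈ 0#
  x≈-x⇒x≈0 x x≈-x = begin
    x                        ≈⟨ *-identityʳ x ⟨
    x * 1#                  ≈⟨ *-congˡ 2v≈1 ⟨
    x * ((1# + 1#) * v)   ≈⟨ *-assoc _ _ _ ⟨
    x * (1# + 1#) * v     ≈⟨ *-congʳ (distribˡ x 1# 1#) ⟩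
    (x * 1# + x * 1#) * v ≈⟨ *-congʳ (+-cong (*-identityʳ x) (trans (*-identityʳ x) x≈-x)) ⟩
    (x + - x) * v         ≈⟨ *-congʳ (-‿inverseʳ x) ⟩
    0# * v                  ≈⟨ zeroˡ v ⟩
    0#                       ∎
    where
    2≉0 : ¬ (1# + 1# ≈ 0#)
    2≉0 2≈0 = 1≉-1 (+-cancelʳ 1# _ _ (trans 2≈0 (sym (-‿inverseˡ 1#))))
    v = proj₁ (inverse (1# + 1#) 2≉0)
    2v≈1 = proj₂ (inverse (1# + 1#) 2≉0)

  -x≈y⇒x≈-y : ∀ {x y} → - x ≈ y → x ≈ - y
  -x≈y⇒x≈-y e = trans (sym (-‿involutive _)) (-‿cong e)

  x≈-y⇒-x≈y : ∀ {x y} → x ≈ - y → - x ≈ y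
  x≈-y⇒-x≈y e = trans (-‿cong e) (-‿involutive _)

  reduced-sym : ∀ {k n} {a b : Atom k (suc n)} →
                Reduced k (λ x → ⟪ a ⟫ x ≈ ⟪ b ⟫ x) → Reduced k (λ x → ⟪ b ⟫ x ≈ ⟪ a ⟫ x)
  reduced-sym (always e)    = always (λ x → sym (e x))
  reduced-sym (tails a b e) = tails a b (λ x → sym ∘ proj₁ (e x) , proj₂ (e x) ∘ sym)
  reduced-sym (heads b e)   = heads b (λ x → sym ∘ proj₁ (e x) , proj₂ (e x) ∘ sym)

  reduce-head⁺ : ∀ {k n} (b : Atom k n) → Reduced {n} k (λ x → x zero ≈ ⟪ rename suc b ⟫ x)
  reduce-head⁺ b = heads b λ x →
    let r = reflexive (⟪⟫-rename suc b x) in (λ e → trans e (sym r)) , (λ e → trans e r)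

  reduce-head⁻ : ∀ {n} (b : Atom signed n) → Reduced {n} signed (λ x → - x zero ≈ ⟪ rename suc b ⟫ x)
  reduce-head⁻ b = heads (negate b) λ x →
    let r = reflexive (⟪⟫-rename suc b x)
        s = ⟪⟫-negate b (x ∘ suc)
    in (λ e → trans (x≈-y⇒-x≈y (trans e s)) (sym r)) , (λ e → trans (-x≈y⇒x≈-y (trans e r)) (sym s))

  reduce-± : ∀ {n} → Reduced {n} signed (λ x → x zero ≈ - x zero)
  reduce-± = heads zer λ x →
    (λ e → trans e (trans (sym -0#≈0#) (-‿cong (sym e)))) , x≈-x⇒x≈0 (x zero)

  reduce : ∀ {k n} (a b : Atom k (suc n)) → Reduced k (λ x → ⟪ a ⟫ x ≈ ⟪ b ⟫ x)
  reduce a b with split a | split b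
  ... | tail a′      | tail b′      = tails a′ b′ λ x →
    let r = reflexive (⟪⟫-rename suc a′ x)
        s = reflexive (⟪⟫-rename suc b′ x)
    in (λ e → trans r (trans e (sym s))) , (λ e → trans (sym r) (trans e s))
  ... | tail a′      | head⁺        = reduced-sym {a = pos zero} {rename suc a′} (reduce-head⁺ a′)
  ... | tail a′      | head⁻ ≡.refl = reduced-sym {a = neg zero} {rename suc a′} (reduce-head⁻ a′)
  ... | head⁺        | tail b′      = reduce-head⁺ b′
  ... | head⁺        | head⁺        = always λ x → refl
  ... | head⁺        | head⁻ ≡.refl = reduce-±
  ... | head⁻ ≡.refl | tail b′      = reduce-head⁻ b′
  ... | head⁻ ≡.refl | head⁺        = reduced-sym {a = pos zero} {neg zero} reduce-±
  ... | head⁻ ≡.refl | head⁻ ≡.refl = always λ x → refl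

  mutual

    -- Elimination by recursion on the code: the equation is reduced with respect to coordinate 0,
    -- and whatever does not involve this coordinate is passed on to the remaining ones.
    meet : ∀ {k m d} (X : Code k m d) (a b : Atom k (m +ℕ base k)) → Meet (_ , X) (λ x → ⟪ a ⟫ x ≈ ⟪ b ⟫ x)
    meet nil a b rewrite atom-unique a | atom-unique b = (_ , nil) , λ x → (λ _ → tt , refl) , λ _ _ → tt
    meet X@(new _)   a b = meet-reduced X (reduce a b)
    meet X@(old _ _) a b = meet-reduced X (reduce a b)

    meet-reduced : ∀ {k m d Q} (X : Code k (suc m) d) → Reduced k Q → Meet (_ , X) Q
    meet-reduced X (always q) = (_ , X) , λ x → (λ Xx → Xx , q x) , λ Xx _ → Xx
    meet-reduced (new X) (tails a b q) =
      let (_ , Z) , z = meet X a b in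
      (_ , new Z) , λ x →
        (λ Zx → let Xx , e = proj₁ (z (x ∘ suc)) Zx in Xx , proj₁ (q x) e) ,
        (λ Xx Qx → proj₂ (z (x ∘ suc)) Xx (proj₂ (q x) Qx))
    meet-reduced (old a₀ X) (tails a b q) =
      let (_ , Z) , z = meet X a b
          a₁ = rename (rep X) a₀
      in
      (_ , put a₁ Z) , λ x →
        let r = reflexive (⟪⟫-rename (rep X) a₀ (x ∘ suc)) in
        (λ Zx → let e₀ , Zx′ = Sat-put⁻ Z a₁ {x} Zx
                    Xx , e   = proj₁ (z (x ∘ suc)) Zx′
                in (trans e₀ r , Xx) , proj₁ (q x) e) ,
        (λ (e₀ , Xx) Qx → Sat-put⁺ Z a₁ {x} (trans e₀ (sym r)) (proj₂ (z (x ∘ suc)) Xx (proj₂ (q x) Qx)))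
    meet-reduced (new X) (heads b q) = (_ , put b X) , λ x →
      (λ Zx → let e , Xx = Sat-put⁻ X b {x} Zx in Xx , proj₁ (q x) e) ,
      (λ Xx Qx → Sat-put⁺ X b {x} (proj₂ (q x) Qx) Xx)
    -- Coordinate 0 is now prescribed twice, so the rest of the code is intersected with the
    -- equation between the two values, after which either may be kept.
    meet-reduced (old a₀ X) (heads b q) =
      let a₁ = rename (rep X) a₀
          (_ , Z) , z = meet X a₁ b
      in
      (_ , put b Z) , λ x →
        let r = reflexive (⟪⟫-rename (rep X) a₀ (x ∘ suc)) in
        (λ Zx → let e , Zx′ = Sat-put⁻ Z b {x} Zx
                    Xx , e′ = proj₁ (z (x ∘ suc)) Zx′
                in (trans e (trans (sym e′) r) , Xx) , proj₁ (q x) e) ,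
        (λ (e₀ , Xx) Qx → let e = proj₂ (q x) Qx in
          Sat-put⁺ Z b {x} e (proj₂ (z (x ∘ suc)) Xx (trans r (trans (sym e₀) e))))

  Sat-top : ∀ {k} m {x} → Sat (top {k} m) x
  Sat-top zero    = tt
  Sat-top (suc m) = Sat-top m

  intersection-code : ∀ k m (S : List (LinearForm (m +ℕ base k))) → All (_∈ 𝒜 k (m +ℕ base k)) S →
                      ∃ λ (X : Flat k m) → ⋂ S ≐ ⋂ (forms X)
  intersection-code k m []      []        = (_ , top m) , (λ _ → Sat⇒⋂ (top m) (Sat-top m)) , (λ _ → [])
  intersection-code k m (f ∷ S) (f∈ ∷ S∈) with 𝒜⇒form k f∈ | intersection-code k m S S∈
  ... | (i , a) , ≡.refl | (_ , X) , S⊆X , X⊆S =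
    let Z , z = meet X (pos i) a in
    Z , (λ { {x} (e ∷ Sx) → Sat⇒⋂ (proj₂ Z) (proj₂ (z x) (⋂⇒Sat X (S⊆X Sx)) (form⁻ i a e)) })
      , (λ {x} Zx → let Xx , e = proj₁ (z x) (⋂⇒Sat (proj₂ Z) Zx) in form⁺ i a e ∷ X⊆S (Sat⇒⋂ X Xx))

  -- By `atom-unique` both sides of any relation have the same normal form on such a flat, so it
  -- lies on every hyperplane.
  dim-zero⇒bottom : ∀ {k m} (X : Code k m 0) → ⋂ (forms (_ , X)) ≐ ⋂ (𝒜 k (m +ℕ base k))
  dim-zero⇒bottom {k} X = (λ Xx → All.tabulate λ f∈ → vanish f∈ (⋂⇒Sat X Xx)) , λ 𝒜x → All.map (All.lookup 𝒜x) (forms∈𝒜 (_ , X))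
    where
    vanish : ∀ {f x} → f ∈ 𝒜 k _ → Sat X x → ⟦ f ⟧ x ≈ 0#
    vanish {x = x} f∈ Xx with (i , a) , ≡.refl ← 𝒜⇒form k f∈ = form⁺ i a (begin
      x i                            ≈⟨ Sat-eval X Xx i ⟩
      ⟪ eval X i ⟫ (x ∘ rep X)       ≡⟨ ≡.cong (λ b → ⟪ b ⟫ (x ∘ rep X)) (≡.trans (atom-unique (eval X i)) (≡.sym (atom-unique (a >>= eval X)))) ⟩
      ⟪ a >>= eval X ⟫ (x ∘ rep X)   ≈⟨ Sat-atom X Xx a ⟨
      ⟪ a ⟫ x                        ∎)

  bottom⇒dim-zero : ∀ {k m} (X : Flat k m) → ⋂ (forms X) ≐ ⋂ (𝒜 k (m +ℕ base k)) → proj₁ X ≡ 0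
  bottom⇒dim-zero {k} {m} X (X⊆ , ⊆X) = ≡.cong proj₁ (forms-injective {Y = X} {_ , bot m}
    ((λ x∈ → proj₂ (dim-zero⇒bottom (bot m)) (X⊆ x∈)) , (λ x∈ → ⊆X (proj₁ (dim-zero⇒bottom (bot m)) x∈))))

filter∈sublists : ∀ {a p} {A : Set a} {P : Pred A p} (P? : Unary.Decidable P) xs → filter P? xs ∈ sublists xs
filter∈sublists P? []       = here ≡.refl
filter∈sublists P? (x ∷ xs) with P? x
... | yes _ = ∈-++⁺ʳ (sublists xs) (∈-map⁺ (x ∷_) (filter∈sublists P? xs))
... | no  _ = ∈-++⁺ˡ (filter∈sublists P? xs)

-- Möbius values and their sums over lower sets

möbius : Kind → ℕ → ℤ
möbius k zero    = 1ℤ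
möbius k (suc c) = ℤ.- (+ atomCount k c ℤ.* möbius k c)

module ∑ℤ = ListSum ℤ.+-0-commutativeMonoid

×-ℤ : ∀ n i → MonoidMult._×_ ℤ.+-0-monoid n i ≡ + n ℤ.* i
×-ℤ zero    i = ≡.sym (ℤ.*-zeroˡ i)
×-ℤ (suc n) i = ≡.trans (≡.cong (ℤ._+_ i) (×-ℤ n i)) (≡.sym (ℤ.suc-* (+ n) i))

-- The one `new` extension has minus `atomCount k c` times the value of each of the `atomCount k c`
-- extensions by `old`.
∑möbius-extensions : ∀ {k m} (X : Flat k m) → ∑ℤ.∑ (λ Y → möbius k (proj₁ Y)) (extensions X) ≡ 0ℤ
∑möbius-extensions {k} (c , X) = begin
  möbius k (suc c) ℤ.+ ∑ℤ.∑ (λ Y → möbius k (proj₁ Y)) (map (λ a → c , old a X) as)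
    ≡⟨ ≡.cong (ℤ._+_ (möbius k (suc c))) (≡.trans (∑ℤ.∑-map (λ Y → möbius k (proj₁ Y)) (λ a → c , old a X) as) (∑ℤ.∑-const (möbius k c) as)) ⟩
  möbius k (suc c) ℤ.+ MonoidMult._×_ ℤ.+-0-monoid (length as) (möbius k c)
    ≡⟨ ≡.cong (ℤ._+_ (möbius k (suc c))) (≡.trans (×-ℤ (length as) (möbius k c)) (≡.cong (λ l → + l ℤ.* möbius k c) (length-atoms k c))) ⟩
  möbius k (suc c) ℤ.+ + atomCount k c ℤ.* möbius k c
    ≡⟨ ℤ.+-inverseˡ (+ atomCount k c ℤ.* möbius k c) ⟩
  0ℤ ∎
  where
  open ≡.≡-Reasoning
  as = atoms k (c +ℕ base k)

-- Positive dimension means that a `new` occurs. At the outermost one the sum splits into vanishing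
-- blocks of extensions; an `old` around it changes no dimension.
∑möbius-below : ∀ {k m c} (X : Code k m c) → 0 < c → ∑ℤ.∑ (λ Y → möbius k (proj₁ Y)) (below X) ≡ 0ℤ
∑möbius-below {k} (new X) _ =
  ≡.trans (∑ℤ.∑-concatMap (λ Y → möbius k (proj₁ Y)) extensions (below X)) (∑ℤ.∑-ε (below X) ∑möbius-extensions)
∑möbius-below {k} (old a X) 0<c =
  ≡.trans (∑ℤ.∑-map (λ Y → möbius k (proj₁ Y)) (putFlat (rename (rep X) a)) (below X)) (∑möbius-below X 0<c)

-- From the lattice of flats to codes

module FlatSums {c ℓ₁ ℓ₂} (K : OrderedField c ℓ₁ ℓ₂) (k : Kind) (m : ℕ) where

  open Arrangements K
  open Dimension K
  open Semantics K

  𝒜ₘ : Arrangement (m +ℕ base k)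
  𝒜ₘ = 𝒜 k (m +ℕ base k)

  open DecPoset (intersections (m +ℕ base k)) using (_≈_; module Eq)
  open Setoid Eq.setoid using () renaming (sym to ≈-sym; trans to ≈-trans; refl to ≈-refl)
  open Membership Eq.setoid using () renaming (_∈_ to _∈ₛ_)
  open Möbius (intersections (m +ℕ base k)) (flats 𝒜ₘ) using ([_,_⟩; _<?_; μ-≈; μ-≉)

  flats-unique : UniqueSetoid.Unique Eq.setoid (flats 𝒜ₘ)
  flats-unique = DecUnique.deduplicate-! (DecPoset.Eq.decSetoid (intersections (m +ℕ base k))) (sublists 𝒜ₘ)

  flat-code : ∀ {S} → S ∈ flats 𝒜ₘ → ∃ λ (X : Flat k m) → S ≈ forms X
  flat-code {S} S∈ = intersection-code k m S (sublists-sound 𝒜ₘ (∈-deduplicate⁻ _≐?_ (sublists 𝒜ₘ) S∈))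

  -- `forms X` need not follow the order of the arrangement. The sublist of all hyperplanes
  -- containing the flat cuts out the same set and is listed by `sublists`.
  code-flat : ∀ (X : Flat k m) → forms X ∈ₛ flats 𝒜ₘ
  code-flat X = Any.deduplicate⁺ _≐?_ (λ T≈S X≈S → ≈-trans X≈S (≈-sym T≈S))
    (lose (filter∈sublists vanishing? 𝒜ₘ)
      ((λ Xx → All.tabulate λ f∈ → All.head (proj₂ (∈-filter⁻ vanishing? {xs = 𝒜ₘ} f∈) Xx)) ,
       (λ Sx → All.tabulate λ f∈ → All.lookup Sx
          (∈-filter⁺ vanishing? (All.lookup (forms∈𝒜 X) f∈) (λ Xx → All.lookup Xx f∈ ∷ [])))))
    where
    vanishing? : Unary.Decidable (λ f → ⋂ (forms X) ⊆ ⋂ (f ∷ []))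
    vanishing? f = forms X ⊆? (f ∷ [])

  forms-unique : ∀ {d} (X : Code k m d) → UniqueSetoid.Unique Eq.setoid (map forms (below X))
  forms-unique X = UniqueSetoidProperties.map⁺ (≡.setoid (Flat k m)) Eq.setoid forms-injective (below-unique X)

  module _ {a ℓ} (M : Algebra.Bundles.CommutativeMonoid a ℓ) where

    open CommutativeMonoid M using (Carrier; _∙_; trans) renaming (_≈_ to _≋_)
    open ListSum M

    ∑-flats : ∀ {f : List (LinearForm (m +ℕ base k)) → Carrier} → (∀ {S T} → S ≈ T → f S ≋ f T) →
              ∑ f (flats 𝒜ₘ) ≋ ∑ (λ X → f (forms X)) (below (top m))
    ∑-flats {f} f-cong = trans
      (∑-unique Eq.setoid f-cong flats-unique (forms-unique (top m)) to from)
      (∑-map f forms (below (top m)))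
      where
      to : ∀ {S} → S ∈ₛ flats 𝒜ₘ → S ∈ₛ map forms (below (top m))
      to S∈ =
        let T , T∈ , S≈T = find S∈
            X , T≈X = flat-code T∈
        in lose (∈-map⁺ forms (below-top X)) (≈-trans S≈T T≈X)

      from : ∀ {S} → S ∈ₛ map forms (below (top m)) → S ∈ₛ flats 𝒜ₘ
      from S∈ =
        let T , T∈ , S≈T = find S∈
            X , _ , T≡X = ∈-map⁻ forms T∈
        in Any.map (≈-trans (≡.subst (_ ≈_) T≡X S≈T)) (code-flat X)

    -- With `S` put back, the half-open interval from the minimum consists of all flats inside `S`,
    -- which `below` enumerates; `below-dim` tells `S` from the others.
    ∑-interval : ∀ {f : List (LinearForm (m +ℕ base k)) → Carrier} → (∀ {S T} → S ≈ T → f S ≋ f T) →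
                 ∀ {S} (X : Flat k m) → S ≈ forms X →
                 f S ∙ ∑ f [ 𝒜ₘ , S ⟩ ≋ ∑ (λ Y → f (forms Y)) (below (proj₂ X))
    ∑-interval {f} f-cong {S} X S≈X = trans
      (∑-unique Eq.setoid f-cong unique (forms-unique (proj₂ X)) to from)
      (∑-map f forms (below (proj₂ X)))
      where
      below? = λ T → (𝒜ₘ ⊆? T) ×-dec (T <? S)

      unique : UniqueSetoid.Unique Eq.setoid (S ∷ [ 𝒜ₘ , S ⟩)
      unique = All.tabulate (λ T∈ S≈T → proj₂ (proj₂ (proj₂ (∈-filter⁻ below? {xs = flats 𝒜ₘ} T∈))) (≈-sym S≈T))
             ∷ UniqueSetoidProperties.filter⁺ Eq.setoid below? flats-unique

      to : ∀ {T} → T ∈ₛ (S ∷ [ 𝒜ₘ , S ⟩) → T ∈ₛ map forms (below (proj₂ X))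
      to (here T≈S) = lose (∈-map⁺ forms (forms-⊆⇒below X X (λ x∈ → x∈))) (≈-trans T≈S S≈X)
      to (there T∈) =
        let U , U∈ , T≈U = find T∈
            U∈flats , _ , U⊆S , _ = ∈-filter⁻ below? {xs = flats 𝒜ₘ} U∈
            Y , U≈Y = flat-code U∈flats
        in lose (∈-map⁺ forms (forms-⊆⇒below Y X (λ Yx → proj₁ S≈X (U⊆S (proj₂ U≈Y Yx))))) (≈-trans T≈U U≈Y)

      from : ∀ {T} → T ∈ₛ map forms (below (proj₂ X)) → T ∈ₛ (S ∷ [ 𝒜ₘ , S ⟩)
      from T∈ with _ , U∈ , T≈U ← find T∈ with Y , Y∈ , ≡.refl ← ∈-map⁻ forms U∈ with below-dim (proj₂ X) Y∈
      ... | inj₂ ≡.refl = here (≈-trans T≈U (≈-sym S≈X))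
      ... | inj₁ d<c =
        let V , V∈ , Y≈V = find (code-flat Y)
            V⊆S : ⋂ V ⊆ ⋂ S
            V⊆S = λ Vx → proj₂ S≈X (below⇒forms-⊆ Y X Y∈ (proj₂ Y≈V Vx))
            V≉S : ¬ (V ≈ S)
            V≉S = λ V≈S → ℕ.<-irrefl (≡.cong proj₁ (forms-injective {Y = Y} {X} (≈-trans Y≈V (≈-trans V≈S S≈X)))) d<c
        in there (lose (∈-filter⁺ below? V∈ (bottom-minimum 𝒜ₘ V∈ , V⊆S , V≉S)) (≈-trans T≈U Y≈V))

  dim-cong : ∀ {S T : List (LinearForm (m +ℕ base k))} → S ≈ T → dim S ≡ dim T
  dim-cong {S} {T} S≈T = dim-unique S (proj₂ (proj₂ (basis T))) S≈T

  rank : List (LinearForm (m +ℕ base k)) → ℕ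
  rank S = dim S ∸ base k

  rank-code : ∀ (X : Flat k m) {S} → S ≈ forms X → rank S ≡ proj₁ X
  rank-code X {S} S≈X = ≡.trans (≡.cong (_∸ base k) (dim-code X S S≈X)) (ℕ.m+n∸n≡m (proj₁ X) (base k))

  -- Strong induction on the dimension. Above the minimum, `μ-≉` gives minus the sum over the
  -- smaller flats, where the claim is known, and `∑möbius-below` says that including `S` makes this
  -- sum 0.
  μ-code : ∀ (X : Flat k m) S → S ≈ forms X → μ 𝒜ₘ (bottom 𝒜ₘ) S ≡ möbius k (proj₁ X)
  μ-code (d , X) = <-rec (λ d → ∀ (X : Code k m d) S → S ≈ forms (d , X) → μ 𝒜ₘ 𝒜ₘ S ≡ möbius k d) step d X
    where
    open ≡.≡-Reasoning

    step : ∀ d → (∀ {e} → e < d → ∀ (Y : Code k m e) T → T ≈ forms (e , Y) → μ 𝒜ₘ 𝒜ₘ T ≡ möbius k e) →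
           ∀ (X : Code k m d) S → S ≈ forms (d , X) → μ 𝒜ₘ 𝒜ₘ S ≡ möbius k d
    step d rec X S S≈X with 𝒜ₘ ≐? S
    ... | yes 𝒜≈S = ≡.trans (μ-≈ 𝒜≈S)
      (≡.cong (möbius k) (≡.sym (bottom⇒dim-zero (d , X) (≈-sym {𝒜ₘ} {forms (d , X)} (≈-trans {𝒜ₘ} {S} {forms (d , X)} 𝒜≈S S≈X)))))
    ... | no  𝒜≉S = begin
      μ 𝒜ₘ 𝒜ₘ S                                  ≡⟨ μ-≉ 𝒜≉S ⟩
      ℤ.- ∑ℤ.∑ (μ 𝒜ₘ 𝒜ₘ) [ 𝒜ₘ , S ⟩             ≡⟨ ≡.cong ℤ.-_ (∑ℤ.∑-cong [ 𝒜ₘ , S ⟩ μ≡G) ⟩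
      ℤ.- ∑ℤ.∑ G [ 𝒜ₘ , S ⟩                      ≡⟨ ℤ.+-identityˡ _ ⟨
      0ℤ ℤ.- ∑ℤ.∑ G [ 𝒜ₘ , S ⟩                   ≡⟨ ≡.cong (λ i → i ℤ.- ∑ℤ.∑ G [ 𝒜ₘ , S ⟩) total ⟨
      G S ℤ.+ ∑ℤ.∑ G [ 𝒜ₘ , S ⟩ ℤ.- ∑ℤ.∑ G [ 𝒜ₘ , S ⟩ ≡⟨ ℤ.+-assoc (G S) _ _ ⟩
      G S ℤ.+ (∑ℤ.∑ G [ 𝒜ₘ , S ⟩ ℤ.- ∑ℤ.∑ G [ 𝒜ₘ , S ⟩) ≡⟨ ≡.cong (ℤ._+_ (G S)) (ℤ.+-inverseʳ (∑ℤ.∑ G [ 𝒜ₘ , S ⟩)) ⟩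
      G S ℤ.+ 0ℤ                                 ≡⟨ ℤ.+-identityʳ (G S) ⟩
      G S                                        ≡⟨ ≡.cong (möbius k) (rank-code (d , X) S≈X) ⟩
      möbius k d                                      ∎
      where
      -- The claimed value as a function of the subspace alone, so that `∑-interval` applies to it.
      G : List (LinearForm (m +ℕ base k)) → ℤ
      G T = möbius k (rank T)

      0<d : ∀ {d} (X : Code k m d) → S ≈ forms (d , X) → 0 < d
      0<d {zero}  X S≈X = contradiction (≈-sym {S} {𝒜ₘ} (≈-trans {S} {forms (0 , X)} {𝒜ₘ} S≈X (dim-zero⇒bottom X))) 𝒜≉S
      0<d {suc _} X _   = s≤s z≤n

      total : G S ℤ.+ ∑ℤ.∑ G [ 𝒜ₘ , S ⟩ ≡ 0ℤ
      total = begin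
        G S ℤ.+ ∑ℤ.∑ G [ 𝒜ₘ , S ⟩
          ≡⟨ ∑-interval ℤ.+-0-commutativeMonoid (λ S≈T → ≡.cong (λ e → möbius k (e ∸ base k)) (dim-cong S≈T)) (d , X) S≈X ⟩
        ∑ℤ.∑ (λ Y → G (forms Y)) (below X)
          ≡⟨ ∑ℤ.∑-cong (below X) (λ {Y} _ → ≡.cong (möbius k) (rank-code Y {forms Y} (≈-refl {forms Y}))) ⟩
        ∑ℤ.∑ (λ Y → möbius k (proj₁ Y)) (below X)
          ≡⟨ ∑möbius-below X (0<d X S≈X) ⟩
        0ℤ ∎

      μ≡G : ∀ {T} → T ∈ [ 𝒜ₘ , S ⟩ → μ 𝒜ₘ 𝒜ₘ T ≡ G T
      μ≡G {T} T∈ with ∈-filter⁻ (λ T → (𝒜ₘ ⊆? T) ×-dec (T <? S)) {xs = flats 𝒜ₘ} T∈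
      ... | T∈flats , _ , T⊆S , T≉S with flat-code T∈flats
      ... | Y , T≈Y with below-dim X (forms-⊆⇒below Y (d , X) (λ Yx → proj₁ S≈X (T⊆S (proj₂ T≈Y Yx))))
      ... | inj₁ e<d    = ≡.trans (rec e<d (proj₂ Y) T T≈Y) (≡.cong (möbius k) (≡.sym (rank-code Y T≈Y)))
      ... | inj₂ ≡.refl = contradiction (≈-trans {T} {forms (d , X)} {S} T≈Y (≈-sym {S} {forms (d , X)} S≈X)) T≉S

  module _ {r ℓ} (R : CommutativeRing r ℓ) where

    private module R = CommutativeRing R
    open Polynomial R
    open RawSemiring (Semiring.rawSemiring R.semiring) using () renaming (_^_ to _^ᴿ_)
    open ListSum R.+-commutativeMonoid

    -- After `μ-code` the summand depends only on the dimension, hence is constant on equal flats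
    -- and the sum can move to codes. In the codimension the two copies of `base k` cancel.
    P-codes : ∀ z → P 𝒜ₘ z R.≈ ∑ (λ X → ∣ möbius k (proj₁ X) ∣ · ((z R.- R.1#) ^ᴿ (m ∸ proj₁ X))) (below (top m))
    P-codes z = begin
      P 𝒜ₘ z
        ≈⟨ ∑-cong (flats 𝒜ₘ) (λ {S} S∈ → let X , S≈X = flat-code S∈ in
             R.reflexive (≡.cong (λ i → ∣ i ∣ · (w ^ᴿ codim S))
               (≡.trans (μ-code X S S≈X) (≡.cong (möbius k) (≡.sym (rank-code X S≈X)))))) ⟩
      ∑ F (flats 𝒜ₘ)
        ≈⟨ ∑-flats R.+-commutativeMonoid (λ S≈T →
             R.reflexive (≡.cong (λ d → ∣ möbius k (d ∸ base k) ∣ · (w ^ᴿ ((m +ℕ base k) ∸ d))) (dim-cong S≈T))) ⟩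
      ∑ (λ X → F (forms X)) (below (top m))
        ≈⟨ ∑-cong (below (top m)) (λ {X} _ → R.reflexive (≡.cong₂ (λ r d → ∣ möbius k r ∣ · (w ^ᴿ d))
             (rank-code X {forms X} (≈-refl {forms X}))
             (≡.trans (≡.cong ((m +ℕ base k) ∸_) (dim-code X (forms X) (≈-refl {forms X})))
                      (≡.trans (≡.cong₂ _∸_ (ℕ.+-comm m (base k)) (ℕ.+-comm (proj₁ X) (base k)))
                               (ℕ.[m+n]∸[m+o]≡n∸o (base k) m (proj₁ X)))))) ⟩
      ∑ (λ X → ∣ möbius k (proj₁ X) ∣ · (w ^ᴿ (m ∸ proj₁ X))) (below (top m)) ∎
      where
      open import Relation.Binary.Reasoning.Setoid R.setoid
      w = z R.- R.1#
      F : List (LinearForm (m +ℕ base k)) → R.Carrier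
      F S = ∣ möbius k (rank S) ∣ · (w ^ᴿ codim S)

∣möbius∣-suc : ∀ k c → ∣ möbius k (suc c) ∣ ≡ atomCount k c *ℕ ∣ möbius k c ∣
∣möbius∣-suc k c = ≡.trans (ℤ.∣-i∣≡∣i∣ (+ atomCount k c ℤ.* möbius k c)) (ℤ.abs-* (+ atomCount k c) (möbius k c))

-- The recursion in operator form and its Leibniz rule

module Recursion {r ℓ} (R : CommutativeRing r ℓ) (w : CommutativeRing.Carrier R) where

  open CommutativeRing R hiding (zero)
  open RawSemiring (Semiring.rawSemiring semiring) using () renaming (_^_ to _^ᴿ_; _×_ to _·_)
  open MonoidMult +-monoid using (×-congʳ; ×-congˡ; ×-homo-+; ×-assocˡ; ×-homo-1)
  open CommutativeMonoidMult +-commutativeMonoid using (×-distrib-+)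
  open SemiringMult semiring using (×-assoc-*; ×-comm-*; ×1-homo-*)
  open ListSum +-commutativeMonoid
  open SetoidReasoning setoid

  -- With θ = s d/ds, t k m c is the value at s = 1 of Tᵐ sᶜ, where T = (s + w)(1 + 2θ), if k is
  -- signed, and of Tᵐ sᶜ⁺¹, where T = (s + w) θ, if k is braid.
  t : Kind → ℕ → ℕ → Carrier
  t k zero    c = 1#
  t k (suc m) c = atomCount k c · (t k m (suc c) + w * t k m c)

  weight : Kind → ℕ → ℕ → Carrier
  weight k m c = ∣ möbius k c ∣ · (w ^ᴿ (m ∸ c))

  -- Turns multiples into products, which the ring solver can handle.
  ·≈* : ∀ n x → n · x ≈ (n · 1#) * x
  ·≈* n x = trans (×-congʳ n (sym (*-identityˡ x))) (sym (×-assoc-* n 1# x))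

  -- Collects the contributions of all extensions of one flat of dimension `c`: the change of weight
  -- becomes an operator on the test function `e`. The bound on `c` makes the exponent of `w` grow
  -- by exactly one.
  weight-step : ∀ k {m c} → c ≤ m → ∀ (e : ℕ → Carrier) →
    weight k (suc m) (suc c) * e (suc c) + atomCount k c · (weight k (suc m) c * e c) ≈
    weight k m c * (atomCount k c · (e (suc c) + w * e c))
  weight-step k {m} {c} c≤m e = begin
    (∣ möbius k (suc c) ∣ · W) * e (suc c) + atomCount k c · ((G · (w ^ᴿ (suc m ∸ c))) * e c)
      ≈⟨ +-cong (*-congʳ (trans (×-congˡ (∣möbius∣-suc k c)) (trans (·≈* (atomCount k c *ℕ G) W) (*-congʳ (×1-homo-* (atomCount k c) G)))))
                (trans (·≈* (atomCount k c) _) (*-congˡ (*-congʳ (trans (·≈* G _) (*-congˡ (reflexive (≡.cong (w ^ᴿ_) (ℕ.+-∸-assoc 1 c≤m)))))))) ⟩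
    A * B * W * e (suc c) + A * (B * (w * W) * e c)
      ≈⟨ solve 6 (λ A B W w e₀ e₁ → A :* B :* W :* e₁ :+ A :* (B :* (w :* W) :* e₀) := B :* W :* (A :* (e₁ :+ w :* e₀))) refl A B W w (e c) (e (suc c)) ⟩
    B * W * (A * (e (suc c) + w * e c))
      ≈⟨ *-cong (·≈* G W) (·≈* (atomCount k c) _) ⟨
    (G · W) * (atomCount k c · (e (suc c) + w * e c)) ∎
    where
    open Solver commutativeSemiring
    G = ∣ möbius k c ∣
    W = w ^ᴿ (m ∸ c)
    A = atomCount k c · 1#
    B = G · 1#

  ∑-codes : Kind → ℕ → (ℕ → Carrier) → Carrier
  ∑-codes k m e = ∑ (λ (X : Flat k m) → weight k m (proj₁ X) * e (proj₁ X)) (below (top m))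

  ∑-codes-suc : ∀ k m e → ∑-codes k (suc m) e ≈ ∑-codes k m (λ c → atomCount k c · (e (suc c) + w * e c))
  ∑-codes-suc k m e = begin
    ∑-codes k (suc m) e                             ≈⟨ ∑-concatMap f extensions (below (top m)) ⟩
    ∑ (λ X → ∑ f (extensions X)) (below (top m))    ≈⟨ ∑-cong (below (top m)) (λ {X} _ → extend X) ⟩
    ∑-codes k m (λ c → atomCount k c · (e (suc c) + w * e c)) ∎
    where
    f : Flat k (suc m) → Carrier
    f Y = weight k (suc m) (proj₁ Y) * e (proj₁ Y)

    extend : ∀ (X : Flat k m) →
             ∑ f (extensions X) ≈ weight k m (proj₁ X) * (atomCount k (proj₁ X) · (e (suc (proj₁ X)) + w * e (proj₁ X)))
    extend (c , X) = trans
      (+-congˡ (trans (∑-map f (λ a → c , old a X) as)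
                (trans (∑-const (weight k (suc m) c * e c) as) (×-congˡ (length-atoms k c)))))
      (weight-step k (code-dim-≤ X) e)
      where as = atoms k (c +ℕ base k)

  -- Each coordinate removed from the codes becomes one more application of the operator, which
  -- raises the first index of `t`.
  ∑-codes-t : ∀ k m n → ∑-codes k m (t k n) ≈ t k (m +ℕ n) 0
  ∑-codes-t k zero    n = trans (+-identityʳ _) (trans (*-congʳ (+-identityʳ 1#)) (*-identityˡ _))
  ∑-codes-t k (suc m) n = trans (∑-codes-suc k m (t k n))
    (trans (∑-codes-t k m (suc n)) (reflexive (≡.cong (λ l → t k l 0) (ℕ.+-suc m n))))

  -- The sum of (n C i) · F i (n ∸ i) over i, unfolded by Pascal's rule: see S-binomial.
  S : ℕ → (ℕ → ℕ → Carrier) → Carrier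
  S zero    F = F 0 0
  S (suc n) F = S n (λ i j → F (suc i) j) + S n (λ i j → F i (suc j))

  S-cong : ∀ n {F G} → (∀ i j → F i j ≈ G i j) → S n F ≈ S n G
  S-cong zero    e = e 0 0
  S-cong (suc n) e = +-cong (S-cong n (λ i j → e (suc i) j)) (S-cong n (λ i j → e i (suc j)))

  S-linear : ∀ n l F G → l · (S n F + w * S n G) ≈ S n (λ i j → l · (F i j + w * G i j))
  S-linear zero    l F G = refl
  S-linear (suc n) l F G = begin
    l · (S n F₁ + S n F₂ + w * (S n G₁ + S n G₂))
      ≈⟨ ×-congʳ l (solve 5 (λ w a b c d → a :+ b :+ w :* (c :+ d) := (a :+ w :* c) :+ (b :+ w :* d)) refl w (S n F₁) (S n F₂) (S n G₁) (S n G₂)) ⟩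
    l · ((S n F₁ + w * S n G₁) + (S n F₂ + w * S n G₂))
      ≈⟨ ×-distrib-+ _ _ l ⟩
    l · (S n F₁ + w * S n G₁) + l · (S n F₂ + w * S n G₂)
      ≈⟨ +-cong (S-linear n l F₁ G₁) (S-linear n l F₂ G₂) ⟩
    S (suc n) (λ i j → l · (F i j + w * G i j)) ∎
    where
    open Solver commutativeSemiring
    F₁ = λ i j → F (suc i) j
    F₂ = λ i j → F i (suc j)
    G₁ = λ i j → G (suc i) j
    G₂ = λ i j → G i (suc j)

  u : ℕ → ℕ → Carrier
  u i c = (2 ^ i) · t braid i c

  -- The recursion of ∂ = 2 (s + w) θ: `suc c` is the eigenvalue of θ at sᶜ⁺¹, and each power of 2
  -- goes with one application.
  u-suc : ∀ i c → u (suc i) c ≈ (2 *ℕ suc c) · (u i (suc c) + w * u i c)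
  u-suc i c = begin
    (2 ^ suc i) · (suc c · (x + w * y))
      ≈⟨ ×-assocˡ _ (2 ^ suc i) (suc c) ⟩
    (2 *ℕ 2 ^ i *ℕ suc c) · (x + w * y)
      ≈⟨ ×-congˡ (ℕ-lemma (2 ^ i) (suc c)) ⟩
    (2 *ℕ suc c *ℕ 2 ^ i) · (x + w * y)
      ≈⟨ ×-assocˡ _ (2 *ℕ suc c) (2 ^ i) ⟨
    (2 *ℕ suc c) · ((2 ^ i) · (x + w * y))
      ≈⟨ ×-congʳ (2 *ℕ suc c) (trans (×-distrib-+ _ _ (2 ^ i)) (+-congˡ (sym (×-comm-* (2 ^ i) w y)))) ⟩
    (2 *ℕ suc c) · (u i (suc c) + w * u i c) ∎
    where
    x = t braid i (suc c)
    y = t braid i c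
    ℕ-lemma : ∀ p q → 2 *ℕ p *ℕ q ≡ 2 *ℕ q *ℕ p
    ℕ-lemma = ℕ-Solver.solve-∀

  -- The product rule on eigenvalues: 1 + 2θ at the product of sᵇ and sᶜ⁺¹ is 2θ at sᶜ⁺¹ plus 1 + 2θ
  -- at sᵇ.
  atomCount-signed-+ : ∀ b c → atomCount signed (b +ℕ suc c) ≡ 2 *ℕ suc c +ℕ atomCount signed b
  atomCount-signed-+ = unfolded
    where
    unfolded : ∀ b c → suc ((b +ℕ suc c) +ℕ (b +ℕ suc c)) ≡ 2 *ℕ suc c +ℕ suc (b +ℕ b)
    unfolded = ℕ-Solver.solve-∀

  -- The Leibniz rule for the derivation ∂ = 2 (s + w) θ, for which u i c is ∂ⁱ sᶜ⁺¹ at s = 1: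
  -- Tⁿ (sᵇ sᶜ⁺¹) = ∑ (n C i) (Tⁿ⁻ⁱ sᵇ) (∂ⁱ sᶜ⁺¹).
  leibniz : ∀ n b c → t signed n (b +ℕ suc c) ≈ S n (λ i j → u i c * t signed j b)
  leibniz zero    b c = sym (trans (*-identityʳ _) (×-homo-1 1#))
  leibniz (suc n) b c = begin
    atomCount signed (b +ℕ suc c) · (x + w * y)
      ≈⟨ ×-congˡ (atomCount-signed-+ b c) ⟩
    (2 *ℕ suc c +ℕ atomCount signed b) · (x + w * y)
      ≈⟨ ×-homo-+ _ (2 *ℕ suc c) (atomCount signed b) ⟩
    (2 *ℕ suc c) · (x + w * y) + atomCount signed b · (x + w * y)
      -- The exponent b + c + 2 in `x` is split in two ways: the extra s joins sᶜ⁺¹ in the part for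
      -- ∂ and sᵇ in the part for T.
      ≈⟨ +-cong (×-congʳ (2 *ℕ suc c) (+-cong (trans (reflexive (≡.cong (t signed n) (≡.sym (ℕ.+-suc b (suc c))))) (leibniz n b (suc c)))
                                              (*-congˡ (leibniz n b c))))
                (×-congʳ (atomCount signed b) (+-cong (leibniz n (suc b) c) (*-congˡ (leibniz n b c)))) ⟩
    (2 *ℕ suc c) · (S n (λ i j → u i (suc c) * t signed j b) + w * S n (λ i j → u i c * t signed j b)) +
    atomCount signed b · (S n (λ i j → u i c * t signed j (suc b)) + w * S n (λ i j → u i c * t signed j b))
      ≈⟨ +-cong (S-linear n (2 *ℕ suc c) _ _) (S-linear n (atomCount signed b) _ _) ⟩
    S n (λ i j → (2 *ℕ suc c) · (u i (suc c) * t signed j b + w * (u i c * t signed j b))) +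
    S n (λ i j → atomCount signed b · (u i c * t signed j (suc b) + w * (u i c * t signed j b)))
      ≈⟨ +-cong (S-cong n (λ i j → left (t signed j b) i))
                (S-cong n (λ i j → right (u i c) (t signed j (suc b)) (t signed j b))) ⟩
    S (suc n) (λ i j → u i c * t signed j b) ∎
    where
    open Solver commutativeSemiring
    x = t signed n (suc (b +ℕ suc c))
    y = t signed n (b +ℕ suc c)

    left : ∀ s i → (2 *ℕ suc c) · (u i (suc c) * s + w * (u i c * s)) ≈ u (suc i) c * s
    left s i = begin
      (2 *ℕ suc c) · (u i (suc c) * s + w * (u i c * s))
        ≈⟨ ×-congʳ (2 *ℕ suc c) (solve 4 (λ w p q s → p :* s :+ w :* (q :* s) := (p :+ w :* q) :* s) refl w (u i (suc c)) (u i c) s) ⟩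
      (2 *ℕ suc c) · ((u i (suc c) + w * u i c) * s)
        ≈⟨ ×-assoc-* (2 *ℕ suc c) _ s ⟨
      (2 *ℕ suc c) · (u i (suc c) + w * u i c) * s
        ≈⟨ *-congʳ (u-suc i c) ⟨
      u (suc i) c * s ∎

    right : ∀ q s₁ s₀ → atomCount signed b · (q * s₁ + w * (q * s₀)) ≈ q * (atomCount signed b · (s₁ + w * s₀))
    right q s₁ s₀ = begin
      atomCount signed b · (q * s₁ + w * (q * s₀))
        ≈⟨ ×-congʳ (atomCount signed b) (solve 4 (λ w q s₁ s₀ → q :* s₁ :+ w :* (q :* s₀) := q :* (s₁ :+ w :* s₀)) refl w q s₁ s₀) ⟩
      atomCount signed b · (q * (s₁ + w * s₀))
        ≈⟨ ×-comm-* (atomCount signed b) q _ ⟨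
      q * (atomCount signed b · (s₁ + w * s₀)) ∎

  ∑< : ℕ → (ℕ → Carrier) → Carrier
  ∑< n f = foldr _+_ 0# (applyUpTo f n)

  ∑<-cong : ∀ n {f h} → (∀ {i} → i < n → f i ≈ h i) → ∑< n f ≈ ∑< n h
  ∑<-cong zero    e = refl
  ∑<-cong (suc n) e = +-cong (e (s≤s z≤n)) (∑<-cong n (λ i<n → e (s≤s i<n)))

  ∑<-+ : ∀ n f h → ∑< n (λ i → f i + h i) ≈ ∑< n f + ∑< n h
  ∑<-+ zero    f h = sym (+-identityˡ 0#)
  ∑<-+ (suc n) f h = trans (+-congˡ (∑<-+ n _ _))
    (solve 4 (λ a b c d → a :+ b :+ (c :+ d) := a :+ c :+ (b :+ d)) refl _ _ _ _)
    where open Solver commutativeSemiring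

  ∑<-last : ∀ n f → ∑< (suc n) f ≈ ∑< n f + f n
  ∑<-last zero    f = +-comm _ _
  ∑<-last (suc n) f = trans (+-congˡ (∑<-last n (λ i → f (suc i)))) (sym (+-assoc _ _ _))

  S-binomial : ∀ n F → S n F ≈ F 0 n + ∑< n (λ i → (n C suc i) · F (suc i) (n ∸ suc i))
  S-binomial zero    F = sym (+-identityʳ _)
  S-binomial (suc n) F = begin
    S n (λ i j → F (suc i) j) + S n (λ i j → F i (suc j))
      ≈⟨ +-cong (S-binomial n (λ i j → F (suc i) j)) (S-binomial n (λ i j → F i (suc j))) ⟩
    (a 0 + ∑< n (λ i → (n C suc i) · a (suc i))) + (F 0 (suc n) + ∑< n (λ i → (n C suc i) · F (suc i) (suc (n ∸ suc i))))
      ≈⟨ +-cong (+-congʳ (sym (×-homo-1 (a 0))))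
                (+-congˡ (trans (∑<-cong n (λ {i} i<n → reflexive (≡.cong (λ l → (n C suc i) · F (suc i) l) (≡.sym (ℕ.+-∸-assoc 1 i<n)))))
                  -- `n C suc n` is 0, so this sum may run one index further and then matches the
                  -- range of the other for Pascal's rule.
                  (sym (trans (∑<-last n (λ i → (n C suc i) · a i))
                    (trans (+-congˡ (×-congˡ (k>n⇒nCk≡0 (ℕ.n<1+n n)))) (+-identityʳ _)))))) ⟩
    ∑< (suc n) (λ i → (n C i) · a i) + (F 0 (suc n) + ∑< (suc n) (λ i → (n C suc i) · a i))
      ≈⟨ solve 3 (λ x y z → x :+ (y :+ z) := y :+ (x :+ z)) refl _ _ _ ⟩
    F 0 (suc n) + (∑< (suc n) (λ i → (n C i) · a i) + ∑< (suc n) (λ i → (n C suc i) · a i))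
      ≈⟨ +-congˡ (∑<-+ (suc n) (λ i → (n C i) · a i) (λ i → (n C suc i) · a i)) ⟨
    F 0 (suc n) + ∑< (suc n) (λ i → (n C i) · a i + (n C suc i) · a i)
      ≈⟨ +-congˡ (∑<-cong (suc n) (λ {i} _ → trans (sym (×-homo-+ (a i) (n C i) (n C suc i))) (×-congˡ (nCk+nC[k+1]≡[n+1]C[k+1] n i)))) ⟩
    F 0 (suc n) + ∑< (suc n) (λ i → (suc n C suc i) · a i) ∎
    where
    open Solver commutativeSemiring
    a : ℕ → Carrier
    a i = F (suc i) (n ∸ i)

  -- One application of T to 1 leaves Tⁿ s + w Tⁿ 1. The Leibniz rule with `b` and `c` both 0
  -- expands the first summand, whose term of index 0 is Tⁿ 1 and joins the second to give the
  -- factor 1 + w.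
  t-recursion : ∀ n → t signed (suc n) 0 ≈ (1# + w) * t signed n 0 +
                ∑< n (λ i → ((n C suc i) *ℕ (2 ^ suc i)) · (t signed (n ∸ suc i) 0 * t braid (suc i) 0))
  t-recursion n = begin
    1 · (t signed n 1 + w * t signed n 0)
      ≈⟨ ×-homo-1 _ ⟩
    t signed n 1 + w * t signed n 0
      ≈⟨ +-congʳ (trans (leibniz n 0 0) (S-binomial n _)) ⟩
    u 0 0 * t signed n 0 + ∑< n (λ i → (n C suc i) · (u (suc i) 0 * t signed (n ∸ suc i) 0)) + w * t signed n 0
      ≈⟨ +-congʳ (+-cong (*-congʳ (×-homo-1 1#)) (∑<-cong n (λ {i} _ → term i))) ⟩
    1# * t signed n 0 + ∑< n (λ i → ((n C suc i) *ℕ (2 ^ suc i)) · (t signed (n ∸ suc i) 0 * t braid (suc i) 0)) + w * t signed n 0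
      ≈⟨ solve 4 (λ o w x y → o :* x :+ y :+ w :* x := (o :+ w) :* x :+ y) refl 1# w _ _ ⟩
    (1# + w) * t signed n 0 + ∑< n (λ i → ((n C suc i) *ℕ (2 ^ suc i)) · (t signed (n ∸ suc i) 0 * t braid (suc i) 0)) ∎
    where
    open Solver commutativeSemiring
    term : ∀ i → (n C suc i) · (u (suc i) 0 * t signed (n ∸ suc i) 0) ≈
                 ((n C suc i) *ℕ (2 ^ suc i)) · (t signed (n ∸ suc i) 0 * t braid (suc i) 0)
    term i = trans (×-congʳ (n C suc i) (trans (×-assoc-* (2 ^ suc i) _ _) (×-congʳ (2 ^ suc i) (*-comm _ _))))
                   (×-assocˡ _ (n C suc i) (2 ^ suc i))

-- The polynomials as values of `t`

module _ {c ℓ₁ ℓ₂ r ℓ} (K : OrderedField c ℓ₁ ℓ₂) (R : CommutativeRing r ℓ) (z : CommutativeRing.Carrier R) where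

  open Arrangements K
  open Polynomial R
  open CommutativeRing R
  open Recursion R (z - 1#)
  open Semantics K
  open ListSum +-commutativeMonoid

  P-𝒜 : ∀ k m → P (𝒜 k (m +ℕ base k)) z ≈ t k m 0
  P-𝒜 k m = trans (FlatSums.P-codes K k m R z)
    -- The inserted factor 1 is the test function `t k 0`.
    (trans (∑-cong (below (top m)) (λ _ → sym (*-identityʳ _)))
    (trans (∑-codes-t k m 0) (reflexive (≡.cong (λ l → t k l 0) (ℕ.+-identityʳ m)))))

  P-𝓑 : ∀ m → P (𝓑 m) z ≈ t signed m 0
  P-𝓑 m = trans (reflexive (≡.cong (λ l → P (𝓑 l) z) (≡.sym (ℕ.+-identityʳ m)))) (P-𝒜 signed m)

theorem6p9 : ∀ {c ℓ₁ ℓ₂ r ℓ} (K : OrderedField c ℓ₁ ℓ₂) (R : CommutativeRing r ℓ) →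
    let open Arrangements K
        open Polynomial R
        open CommutativeRing R
    in (z : Carrier) →
       (P (𝓑 0) z ≈ 1#) ×
       (∀ n → 1 ≤ n →
         P (𝓑 n) z ≈
           (z * P (𝓑 (n ∸ 1)) z) +
           ∑₁ (n ∸ 1) (λ k → (((n ∸ 1) C k) *ℕ (2 ^ k)) · (P (𝓑 ((n ∸ 1) ∸ k)) z * P (𝓐 (k +ℕ 1)) z)))
theorem6p9 K R z = P-𝓑 K R z 0 , λ { (suc n) _ → trans (P-𝓑 K R z (suc n)) (trans (t-recursion n)
  (+-cong (*-cong 1+w≈z (sym (P-𝓑 K R z n)))
          -- `∑₁` starts at 1, so index `i` stands for k = i + 1. The dimension k + 1 of the braid
          -- arrangement is then `suc i` plus `base braid`.
          (∑<-cong n λ {i} _ → ×-congʳ ((n C suc i) *ℕ (2 ^ suc i)) (*-cong (sym (P-𝓑 K R z (n ∸ suc i))) (sym (P-𝒜 K R z braid (suc i))))))) }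
  where
  open CommutativeRing R
  open Recursion R (z - 1#)
  open MonoidMult +-monoid using (×-congʳ)
  1+w≈z : 1# + (z - 1#) ≈ z
  1+w≈z = trans (+-comm 1# (z - 1#)) (trans (+-assoc z (- 1#) 1#) (trans (+-congˡ (-‿inverseˡ 1#)) (+-identityʳ z)))
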